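{- The distance to linear forest is incomparable to the bandwidth, to the skeleton dimension, and to each of the highway dimensions $hd_1$ and $hd_2$. That is, for each $q\in\{bw,\kappa,hd_1,hd_2\}$, neither of $q$ and the distance to linear forest is bounded by a function of the other on the class of weighted graphs.
   Context: Graphs $G=(V,E)$ are finite, simple, undirected and connected, with $n$ nodes and edge weights $\ell\colon E\to\mathbb{Q}^+$; $\mathrm{dist}(u,v)$ is the shortest path distance, and the shortest path between any two nodes is assumed to be unique. $B_r(u)=\{v\in V:\mathrm{dist}(u,v)\le r\}$, and $|\pi|$ is the length (total weight) of a path $\pi$. A hitting set for a set of paths is a set of nodes containing at least one node of each path; a path intersects a ball if it contains a node of it. Parameters $p,q$ are incomparable if there is no function $f\colon\mathbb{N}\to\mathbb{N}$ with $p(G)\le f(q(G))$ for all $G$ and no function $g\colon\mathbb{N}\to\mathbb{N}$ with $q(G)\le g(p(G))$ for all $G$. Parameters of unweighted graphs are applied to weighted graphs by ignoring the weights. The distance to linear forest of $G$ is the size of the smallest set $S\subseteq V$ that separates $G$ into a set of disjoint paths, i.e. such that $G-S$ is a disjoint union of paths. The bandwidth $bw$ of $G$ is the minimum, over all bijections $f\colon V\to\{1,\dots,n\}$, of $\max\{|f(u)-f(v)| : \{u,v\}\in E\}$. Geometric realization: $\tilde G=(\tilde V,\tilde E)$ is the continuous version of $G$ in which every edge $\{u,v\}$ is replaced by a segment of length $\ell(\{u,v\})$; thus $V\subseteq\tilde V$, distances between nodes of $V$ are unchanged, and for every edge $\{u,v\}$ and $0\le\alpha\le\ell(\{u,v\})$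 there is a point $w\in\tilde V$ on it with $\mathrm{dist}(u,w)=\alpha$ and $\mathrm{dist}(w,v)=\ell(\{u,v\})-\alpha$. Skeleton dimension: for $s\in V$ let $T_s$ be the shortest path tree of $s$ and $\tilde T_s$ its geometric realization. The skeleton $T_s^*$ is the subtree of $\tilde T_s$ induced by all points $v$ that have a descendant $w$ in $\tilde T_s$ (rooted at $s$) with $\mathrm{dist}(v,w)\ge\frac12\mathrm{dist}(s,v)$. For $r\ge 0$, $\mathrm{Cut}_s^r$ is the set of all points $u$ of $T_s^*$ with $\mathrm{dist}(s,u)=r$. The skeleton dimension of $G$ is $\kappa=\max_{s,r}|\mathrm{Cut}_s^r|$. $hd_1$ is the smallest integer such that for any radius $r>0$ and any node $u$ there is a hitting set $S\subseteq B_{4r}(u)$ of size at most $hd_1$ for the set of all shortest paths $\pi$ with $|\pi|>r$ and $\pi\subseteq B_{4r}(u)$. $hd_2$ is the smallest integer such that for any radius $r>0$ and any node $u$ there is a hitting set $S\subseteq V$ of size at most $hd_2$ for the set of all shortest paths $\pi$ with $2r\ge|\pi|>r$ that intersect $B_{2r}(u)$. -}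

module Defs where

open import Data.Fin.Base using (Fin; toℕ)
open import Data.Fin.Permutation using (Permutation′; _⟨$⟩ʳ_)
open import Data.Fin.Subset using (Subset; ∣_∣) renaming (_∈_ to _∈ˢ_; _∉_ to _∉ˢ_)
open import Data.Integer.Base using (+_)
open import Data.List.Base using (List; []; _∷_; length; map; filter; concat; allFin; cartesianProduct)
open import Data.List.Extrema.Nat using (max)
open import Data.List.Membership.Propositional using (_∈_)
open import Data.List.Relation.Binary.Infix.Heterogeneous using (Infix)
open import Data.List.Relation.Unary.All using (All)
open import Data.List.Relation.Unary.Any using (Any)
open import Data.List.Relation.Unary.Unique.Propositional using (Unique)
open import Data.Nat.Base as ℕ using (ℕ; NonZero)
open import Data.Product using (Σ; ∃; ∃₂; ∃!; _×_; _,_; proj₁; proj₂; uncurry)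
open import Data.Rational.Base using (ℚ; 0ℚ; ½; _+_; _-_; _*_; _/_; _≤_; _<_; _≥_; _>_)
open import Data.Sum.Base using (_⊎_)
open import Data.Unit.Base using (⊤)
open import Function.Bundles using (_⇔_)
open import Level using (0ℓ)
open import Relation.Binary.Construct.Closure.ReflexiveTransitive using (Star; ε; _◅_)
open import Relation.Binary.Core using (Rel)
open import Relation.Binary.Definitions using (Decidable; Symmetric; Irreflexive)
open import Relation.Binary.PropositionalEquality.Core using (_≡_)
open import Relation.Nullary.Negation.Core using (¬_)

IsLeast : (ℕ → Set) → ℕ → Set
IsLeast P k = P k × (∀ m → P m → k ℕ.≤ m)

IsGreatest : (ℕ → Set) → ℕ → Set
IsGreatest P k = P k × (∀ m → P m → m ℕ.≤ k)

HasCardinality : {A : Set} → (A → Set) → ℕ → Set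
HasCardinality {A} P k =
  ∃ λ (xs : List A) → Unique xs × (∀ x → P x ⇔ x ∈ xs) × length xs ≡ k

-- u occurs in the list, immediately followed by v.
Consecutive : {A : Set} → A → A → List A → Set
Consecutive u v xs = Infix _≡_ (u ∷ v ∷ []) xs

------------------------------------------------------------------------
-- Graphs

record Graph : Set₁ where
  field
    n         : ℕ
    nonEmpty  : NonZero n
    E         : Rel (Fin n) 0ℓ
    E?        : Decidable E
    symmetric : Symmetric E
    loopless  : Irreflexive _≡_ E
    connected : ∀ u v → Star E u v

  V : Set
  V = Fin n

module _ {n : ℕ} {E : Rel (Fin n) 0ℓ} where

  nodes : ∀ {u v} → Star E u v → List (Fin n)
  nodes {u} ε       = u ∷ []
  nodes {u} (_ ◅ π) = u ∷ nodes π

  module _ (ℓ : ∀ {u v} → E u v → ℚ) where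

    pathLength : ∀ {u v} → Star E u v → ℚ
    pathLength ε       = 0ℚ
    pathLength (e ◅ π) = ℓ e + pathLength π

    -- Minimality is among all walks; as weights are positive, a minimal
    -- walk repeats no node.
    Shortest : ∀ {u v} → Star E u v → Set
    Shortest {u} {v} π = ∀ (ρ : Star E u v) → pathLength π ≤ pathLength ρ

  -- Paths are identified with their node sequences; elements of E u v may
  -- carry irrelevant proof data.
  SamePath : ∀ {u v} → Star E u v → Star E u v → Set
  SamePath π ρ = nodes π ≡ nodes ρ

record WeightedGraph : Set₁ where
  field
    graph : Graph
  open Graph graph public
  field
    ℓ              : ∀ {u v} → E u v → ℚ
    ℓ-symmetric    : ∀ {u v} (e : E u v) (e′ : E v u) → ℓ e ≡ ℓ e′
    ℓ-positive     : ∀ {u v} (e : E u v) → ℓ e > 0ℚ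
    uniqueShortest : ∀ u v → ∃! (SamePath {E = E} {u} {v}) (Shortest ℓ)

  ∥_∥ : ∀ {u v} → Star E u v → ℚ
  ∥ π ∥ = pathLength ℓ π

  shortestPath : ∀ u v → Star E u v
  shortestPath u v = proj₁ (uniqueShortest u v)

  dist : V → V → ℚ
  dist u v = ∥ shortestPath u v ∥

  Ball : ℚ → V → V → Set
  Ball r u v = dist u v ≤ r

------------------------------------------------------------------------
-- Graph parameters, as relations "the parameter of G has value k"

Parameter : Set₁
Parameter = WeightedGraph → ℕ → Set

BoundedBy : Parameter → Parameter → (ℕ → ℕ) → Set₁
BoundedBy p q f = ∀ G a b → p G a → q G b → a ℕ.≤ f b

Incomparable : Parameter → Parameter → Set₁
Incomparable p q = ¬ (∃ λ f → BoundedBy p q f) × ¬ (∃ λ g → BoundedBy q p g)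

module _ (G : Graph) where
  open Graph G

  -- G − S is the disjoint union of the paths listed in ps.
  SeparatesIntoPaths : Subset n → List (List V) → Set
  SeparatesIntoPaths S ps =
    Unique (concat ps) ×
    (∀ v → v ∉ˢ S ⇔ v ∈ concat ps) ×
    (∀ u v → u ∉ˢ S → v ∉ˢ S →
       E u v ⇔ Any (λ p → Consecutive u v p ⊎ Consecutive v u p) ps)

  IsDistanceToLinearForest : ℕ → Set
  IsDistanceToLinearForest = IsLeast λ k →
    ∃ λ (S : Subset n) → ∣ S ∣ ≡ k × ∃ λ ps → SeparatesIntoPaths S ps

  -- An ordering takes values 0, …, n − 1 instead of 1, …, n.  The default
  -- value 0 of max only matters for the graph without edges.
  stretch : Permutation′ n → ℕ
  stretch f = max 0 (map (λ (u , v) → ℕ.∣ toℕ (f ⟨$⟩ʳ u) - toℕ (f ⟨$⟩ʳ v) ∣)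
                         (filter (uncurry E?) (cartesianProduct (allFin n) (allFin n))))

  IsBandwidth : ℕ → Set
  IsBandwidth = IsLeast λ k → ∃ λ f → stretch f ≡ k

ignoringWeights : (Graph → ℕ → Set) → Parameter
ignoringWeights p G = p (WeightedGraph.graph G)

module _ (G : WeightedGraph) where
  open WeightedGraph G

  Hits : ∀ {u v} → Subset n → Star E u v → Set
  Hits S π = Any (_∈ˢ S) (nodes π)

  IsHighwayDimension₁ : ℕ → Set
  IsHighwayDimension₁ = IsLeast λ k → ∀ r → r > 0ℚ → ∀ u →
    ∃ λ (S : Subset n) →
      (∀ v → v ∈ˢ S → Ball (+ 4 / 1 * r) u v) ×
      ∣ S ∣ ℕ.≤ k ×
      (∀ {a b} (π : Star E a b) → Shortest ℓ π → ∥ π ∥ > r →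
         All (Ball (+ 4 / 1 * r) u) (nodes π) → Hits S π)

  IsHighwayDimension₂ : ℕ → Set
  IsHighwayDimension₂ = IsLeast λ k → ∀ r → r > 0ℚ → ∀ u →
    ∃ λ (S : Subset n) →
      ∣ S ∣ ℕ.≤ k ×
      (∀ {a b} (π : Star E a b) → Shortest ℓ π →
         + 2 / 1 * r ≥ ∥ π ∥ → ∥ π ∥ > r →
         Any (Ball (+ 2 / 1 * r) u) (nodes π) → Hits S π)

  -- Points of the geometric realization: inner u v α is the point at
  -- distance α from u in the open segment of the edge {u , v}.  In a
  -- shortest path tree u is always the parent of v, so that each point has
  -- exactly one representation.
  data Point : Set where
    node  : V → Point
    inner : V → V → ℚ → Point

  module _ (s : V) where

    -- The shortest path tree of s is the union of the shortest paths from s.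
    Parent : V → V → Set
    Parent u v = ∃ λ x → Consecutive u v (nodes (shortestPath s x))

    InTree : Point → Set
    InTree (node v)      = ⊤
    InTree (inner u v α) = Parent u v × Σ (E u v) λ e → 0ℚ < α × α < ℓ e

    depth : Point → ℚ
    depth (node v)      = dist s v
    depth (inner u v α) = dist s u + α

    -- Ancestor x y: x lies on the path from s to y in the realization of
    -- the tree.
    Ancestor : Point → Point → Set
    Ancestor (node u)      (node v)      = u ∈ nodes (shortestPath s v)
    Ancestor (node u)      (inner c d β) = u ∈ nodes (shortestPath s c)
    Ancestor (inner a b α) (node v)      = Consecutive a b (nodes (shortestPath s v))
    Ancestor (inner a b α) (inner c d β) =
      Consecutive a b (nodes (shortestPath s c)) ⊎ (a ≡ c × b ≡ d × α ≤ β)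

    -- If x is an ancestor of y, their distance in the tree is the
    -- difference of their depths.
    InSkeleton : Point → Set
    InSkeleton x = InTree x ×
      ∃ λ y → InTree y × Ancestor x y × depth y - depth x ≥ ½ * depth x

    Cut : ℚ → Point → Set
    Cut r x = InSkeleton x × depth x ≡ r

  IsSkeletonDimension : ℕ → Set
  IsSkeletonDimension = IsGreatest λ k →
    ∃₂ λ s r → r ≥ 0ℚ × HasCardinality (Cut s r) k

{-# OPTIONS --safe #-}

-- Removing the hub of a windmill (a hub joined to both ends of each of m disjoint edges)
-- leaves disjoint edges.  With unit weights, however, the hub has degree 2m, its skeleton
-- branches 2m times, and the m edges are disjoint shortest paths close to the hub.
-- Conversely, in the square of a path every three consecutive nodes form a triangle, so
-- the distance to linear forest is large, while the bandwidth is 2.  Making the edges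
-- {i , i + 2} longer than the detour through i + 1, the shortest paths are those of the
-- underlying path: it branches at most twice at any node, and if the nodes are placed at
-- 1, 8, 8², … then the upper end of a shortest path determines its scale, so that one node
-- hits all paths of a given scale.

module Submission where

open import Defs
open import Data.Empty as Empty using ()
open import Data.Fin.Base using (Fin; zero; suc; toℕ; fromℕ; fromℕ<; inject₁;
  combine; quotient; remQuot)
import Data.Fin.Permutation as Perm
open import Data.Fin.Permutation using (Permutation′; _⟨$⟩ʳ_; _⟨$⟩ˡ_; inverseʳ)
open import Data.Fin.Properties
  using (_≟_; any?; injective⇒≤; suc-injective; toℕ-injective; toℕ<n; toℕ-fromℕ; toℕ-fromℕ<;
         toℕ-inject₁; toℕ-combine; remQuot-combine; combine-remQuot; combine-injective;
         combine-injectiveˡ)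
open import Data.Fin.Subset using (Subset; ∣_∣; ⊤; ⊥; ⁅_⁆)
  renaming (_∈_ to _∈ˢ_; _∉_ to _∉ˢ_; _-_ to _─_)
open import Data.Fin.Subset.Properties
  using (_∈?_; ∈⊤; ∉⊥; ∣⊥∣≡0; ∣p∣≤n; x∈⁅x⁆; x∈⁅y⁆⇒x≡y; ∣⁅x⁆∣≡1; x∈p∧x≢y⇒x∈p-y; x∈p⇒∣p-x∣<∣p∣)
open import Data.Integer.Base using (+_)
open import Data.List.Base as List
  using (List; []; _∷_; length; map; allFin; cartesianProduct; concat; lookup; _++_; upTo)
open import Data.List.Extrema.Nat using (max; xs≤max; max≤v⁺)
open import Data.List.Membership.Propositional using (_∈_; _∉_)
open import Data.List.Membership.Propositional.Properties
  using (∈-lookup; ∈-map⁺; ∈-++⁺ˡ; ∈-++⁺ʳ; ∈-allFin; ∈-cartesianProduct⁺; ∈-upTo⁺; ∈-filter⁺;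
         ∈-tabulate⁺; ∈-tabulate⁻; ∈-concat⁺′; ∈-concat⁻′)
open import Data.List.Membership.Propositional.Properties.WithK using (unique⇒irrelevant)
open import Data.List.Properties using (length-++; length-map; length-tabulate)
open import Data.List.Relation.Binary.Infix.Heterogeneous using (here; there; _++ⁱ_; _ⁱ++_)
open import Data.List.Relation.Binary.Prefix.Heterogeneous using (Prefix; []; _∷_)
open import Data.List.Relation.Unary.All as All using (All; []; _∷_)
import Data.List.Relation.Unary.All.Properties as Allₚ
open import Data.List.Relation.Unary.AllPairs using ([]; _∷_)
import Data.List.Relation.Unary.AllPairs.Properties as AllPairsₚ
open import Data.List.Relation.Unary.Any as Any using (Any; here; there; index)
import Data.List.Relation.Unary.Any.Properties as Anyₚ
open import Data.List.Relation.Unary.Unique.Propositional using (Unique)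
import Data.List.Relation.Unary.Unique.Propositional.Properties as Uniqueₚ
open import Data.Nat.Base as ℕ using (ℕ; zero; suc; z≤n; s≤s)
import Data.Nat.Properties as ℕₚ
open import Data.Product using (∃; ∃₂; ∃!; _×_; _,_; proj₁; proj₂; uncurry)
open import Data.Rational.Base as ℚ using (ℚ; 0ℚ; 1ℚ; ½; _≤_; _<_; _+_; _*_; _-_; _/_)
import Data.Rational.Properties as ℚₚ
import Algebra.Properties.Group ℚₚ.+-0-group as ℚ+
import Data.Rational.Solver as ℚSolver
open import Data.Sum.Base as Sum using (_⊎_; inj₁; inj₂; [_,_]′)
open import Data.Unit.Base using (tt)
open import Data.Vec.Base using (tabulate)
open import Data.Vec.Properties using (lookup∘tabulate; lookup⇒[]=; []=⇒lookup)
open import Function.Base using (_∘_; id)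
open import Function.Bundles using (_⇔_; mk⇔; Equivalence)
open import Relation.Binary.Construct.Closure.ReflexiveTransitive using (Star; ε; _◅_)
open import Relation.Binary.Definitions using (tri<; tri≈; tri>) renaming (Decidable to Decidable₂)
open import Relation.Binary.PropositionalEquality
open import Relation.Nullary.Decidable
  using (Dec; yes; no; does; map′; _⊎-dec_; _×-dec_; dec-true; from-no; from-yes; ¬¬-excluded-middle)
open import Relation.Nullary.Negation using (¬_; contradiction)

private variable
  A B : Set
  size : ℕ

-- Classical reasoning under double negation

_>>=_ : ¬ ¬ A → (A → ¬ ¬ B) → ¬ ¬ B
(¬¬a >>= f) ¬b = ¬¬a λ a → f a ¬b

return : A → ¬ ¬ A
return a ¬a = ¬a a

-- An undecidable `P` need not have a least element constructively, but incomparability is a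
-- negation, so double negation suffices. The search raises `b` until the first number satisfying
-- `P`, at the latest `k`.
least-exists : ∀ {P : ℕ → Set} {k} → P k → ¬ ¬ ∃ (IsLeast P)
least-exists {P} {k} Pk = search (suc k) >>= λ where
    (inj₁ found) → return found
    (inj₂ none)  → contradiction Pk (none k ℕₚ.≤-refl)
  where
  search : ∀ b → ¬ ¬ (∃ (IsLeast P) ⊎ (∀ m → m ℕ.< b → ¬ P m))
  search zero    = return (inj₂ λ _ ())
  search (suc b) = search b >>= λ where
    (inj₁ found) → return (inj₁ found)
    (inj₂ none)  → ¬¬-excluded-middle >>= λ where
      (yes Pb) → return (inj₁ (b , Pb , λ m Pm → ℕₚ.≮⇒≥ λ m<b → none m m<b Pm))
      (no ¬Pb) → return (inj₂ λ m m<1+b Pm →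
        [ (λ m<b → none m m<b Pm) , (λ { refl → ¬Pb Pm }) ]′ (ℕₚ.m<1+n⇒m<n∨m≡n m<1+b))

-- The bound is lowered while it fails `P`; this stops at zero at the latest, where `P k` forces `k`
-- to be zero.
greatest-exists : ∀ {P : ℕ → Set} {k} b → (∀ m → P m → m ℕ.≤ b) → P k → ¬ ¬ ∃ (IsGreatest P)
greatest-exists {P} {k} b bounded Pk = ¬¬-excluded-middle >>= λ where
    (yes Pb) → return (b , Pb , bounded)
    (no ¬Pb) → lower b ¬Pb bounded
  where
  lower : ∀ b → ¬ P b → (∀ m → P m → m ℕ.≤ b) → ¬ ¬ ∃ (IsGreatest P)
  lower zero    ¬P0 bounded = contradiction (subst P (ℕₚ.n≤0⇒n≡0 (bounded k Pk)) Pk) ¬P0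
  lower (suc b) ¬Pb bounded = greatest-exists b
    (λ m Pm → ℕₚ.m<1+n⇒m≤n (ℕₚ.≤∧≢⇒< (bounded m Pm) λ { refl → ¬Pb Pm })) Pk

-- Cardinalities

lookup-injective : ∀ {xs : List A} → Unique xs → ∀ {i j} → lookup xs i ≡ lookup xs j → i ≡ j
lookup-injective (x∉ ∷ xs!) {zero}  {zero}  eq = refl
lookup-injective (x∉ ∷ xs!) {zero}  {suc j} eq = contradiction eq (All.lookup x∉ (∈-lookup j))
lookup-injective (x∉ ∷ xs!) {suc i} {zero}  eq = contradiction (sym eq) (All.lookup x∉ (∈-lookup i))
lookup-injective (x∉ ∷ xs!) {suc i} {suc j} eq = cong suc (lookup-injective xs! eq)

-- Each position in `xs` is sent to a position in `ys` with the same element; uniqueness of `xs`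
-- makes this map injective.
⊆⇒length≤ : ∀ {xs ys : List A} → Unique xs → (∀ {x} → x ∈ xs → x ∈ ys) → length xs ℕ.≤ length ys
⊆⇒length≤ {xs = xs} {ys} xs! xs⊆ys = injective⇒≤ {f = f} λ {i} {j} fi≡fj → lookup-injective xs! (begin
  lookup xs i      ≡⟨ Anyₚ.lookup-index (member i) ⟩
  lookup ys (f i)  ≡⟨ cong (lookup ys) fi≡fj ⟩
  lookup ys (f j)  ≡⟨ Anyₚ.lookup-index (member j) ⟨
  lookup xs j      ∎)
  where
  open ≡-Reasoning
  member : ∀ i → lookup xs i ∈ ys
  member i = xs⊆ys (∈-lookup i)
  f = λ i → index (member i)

injective-on⇒length≤ : ∀ {xs : List A} {c} → Unique xs → (f : ∀ {x} → x ∈ xs → Fin c) →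
  (∀ {x y} (p : x ∈ xs) (q : y ∈ xs) → f p ≡ f q → x ≡ y) → length xs ℕ.≤ c
injective-on⇒length≤ {xs = xs} xs! f inj =
  injective⇒≤ {f = λ i → f (∈-lookup {xs = xs} i)} λ eq → lookup-injective xs! (inj _ _ eq)

cardinality-exists : ∀ {P : A → Set} ys → (∀ {x} → P x → x ∈ ys) → ¬ ¬ ∃ (HasCardinality P)
cardinality-exists {P = P} ys P⊆ys = select ys >>= λ (xs , xs! , P⇔xs) → return
  (length xs , xs , xs! , (λ x → mk⇔ (λ Px → Equivalence.to (P⇔xs x) (Px , P⊆ys Px))
                                     (proj₁ ∘ Equivalence.from (P⇔xs x))) , refl)
  where
  select : ∀ ys → ¬ ¬ ∃ λ xs → Unique xs × (∀ x → (P x × x ∈ ys) ⇔ x ∈ xs)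
  select []       = return ([] , [] , λ x → mk⇔ (λ ()) (λ ()))
  select (y ∷ ys) = select ys >>= λ (xs , xs! , xs⇔) →
    -- Asking for novelty together with `P y` keeps the list free of repetitions, which `ys` may
    -- have.
    ¬¬-excluded-middle {A = P y × y ∉ xs} >>= λ where
      (yes (Py , y∉xs)) → return (y ∷ xs ,
        All.tabulate (λ z∈xs → λ { refl → y∉xs z∈xs }) ∷ xs! ,
        λ x → mk⇔ (λ { (Px , here refl)  → here refl
                     ; (Px , there x∈ys) → there (Equivalence.to (xs⇔ x) (Px , x∈ys)) })
                  (λ { (here refl)  → Py , here refl
                     ; (there x∈xs) → let Px , x∈ys = Equivalence.from (xs⇔ x) x∈xs in Px , there x∈ys }))
      -- Equality on `A` need not be decidable, so membership too is decided only under double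
      -- negation; if `P y` holds, then `y` is in the list already.
      (no ¬new) → ¬¬-excluded-middle {A = y ∈ xs} >>= λ y∈?xs → return (xs , xs! ,
        λ x → mk⇔ (λ { (Px , here refl)  → old ¬new y∈?xs Px
                     ; (Px , there x∈ys) → Equivalence.to (xs⇔ x) (Px , x∈ys) })
                  (λ x∈xs → let Px , x∈ys = Equivalence.from (xs⇔ x) x∈xs in Px , there x∈ys))
    where
    old : ∀ {y xs} → ¬ (P y × y ∉ xs) → Dec (y ∈ xs) → P y → y ∈ xs
    old ¬new (yes y∈xs) Py = y∈xs
    old ¬new (no  y∉xs) Py = contradiction (Py , y∉xs) ¬new

injection⇒≤∣S∣ : ∀ {m} (S : Subset size) (h : Fin m → Fin size) →
  (∀ {i j} → h i ≡ h j → i ≡ j) → (∀ i → h i ∈ˢ S) → m ℕ.≤ ∣ S ∣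
injection⇒≤∣S∣ {m = zero}  S h inj h∈S = z≤n
injection⇒≤∣S∣ {m = suc m} S h inj h∈S = ℕₚ.≤-<-trans
  (injection⇒≤∣S∣ (S ─ h zero) (h ∘ suc) (suc-injective ∘ inj)
    (λ i → x∈p∧x≢y⇒x∈p-y (h∈S (suc i)) (λ eq → contradiction (inj eq) λ ())))
  (x∈p⇒∣p-x∣<∣p∣ (h∈S zero))

subset : {P : Fin size → Set} → (∀ v → Dec (P v)) → Subset size
subset P? = tabulate (does ∘ P?)

∈-subset⁺ : ∀ {P : Fin size → Set} (P? : ∀ v → Dec (P v)) {v} → P v → v ∈ˢ subset P?
∈-subset⁺ P? {v} Pv = lookup⇒[]= v _ (trans (lookup∘tabulate (does ∘ P?) v) (dec-true (P? v) Pv))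

∈-subset⁻ : ∀ {P : Fin size → Set} (P? : ∀ v → Dec (P v)) {v} → v ∈ˢ subset P? → P v
∈-subset⁻ P? {v} v∈ with P? v | trans (sym (lookup∘tabulate (does ∘ P?) v)) ([]=⇒lookup v∈)
... | yes Pv | _ = Pv

-- Supplies the one-element hitting sets: `S` is exactly `P`, and empty when no node satisfies it.
at-most-one : ∀ {P : Fin size → Set} → (∀ v → Dec (P v)) → (∀ {u v} → P u → P v → u ≡ v) →
  ∃ λ S → (∀ {v} → v ∈ˢ S → P v) × ∣ S ∣ ℕ.≤ 1 × (∀ {v} → P v → v ∈ˢ S)
at-most-one {size} {P} P? unique with any? P?
... | yes (w , Pw) = ⁅ w ⁆ , (λ v∈ → subst P (sym (x∈⁅y⁆⇒x≡y w v∈)) Pw) , ℕₚ.≤-reflexive (∣⁅x⁆∣≡1 w) ,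
  λ Pv → subst (_∈ˢ ⁅ w ⁆) (unique Pw Pv) (x∈⁅x⁆ w)
... | no none = ⊥ , (λ v∈ → contradiction v∈ ∉⊥) , ℕₚ.≤-trans (ℕₚ.≤-reflexive (∣⊥∣≡0 size)) z≤n ,
  λ {v} Pv → contradiction (v , Pv) none

-- Comparing parameters

-- Both include that a value exists, because `BoundedBy` is silent about graphs on which a parameter
-- has none.
AtLeast AtMost : Parameter → WeightedGraph → ℕ → Set
AtLeast p G m = ¬ ¬ ∃ λ a → p G a × m ℕ.≤ a
AtMost  p G m = ¬ ¬ ∃ λ a → p G a × a ℕ.≤ m

unbounded : ∀ {p q : Parameter} c → (∀ m → ∃ λ G → AtLeast p G m × AtMost q G c) →
  ¬ ∃ (BoundedBy p q)
unbounded c family (f , bounded) =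
  -- `f` need not be monotone, so its values at 0, ..., `c` are bounded together.
  let bound = max 0 (map f (upTo (suc c)))
      G , large , small = family (suc bound)
  in (large >>= λ (a , pa , bound<a) → small >>= λ (b , qb , b≤c) →
      contradiction (ℕₚ.≤-trans bound<a (ℕₚ.≤-trans (bounded G a b pa qb)
        (All.lookup (xs≤max 0 (map f (upTo (suc c)))) (∈-map⁺ f (∈-upTo⁺ (s≤s b≤c)))))) ℕₚ.1+n≰n)
     id

-- The equation determines P, which unification cannot read off P k.
least≥ : ∀ (p : Parameter) G {P k m} → p G ≡ IsLeast P →
  P k → (∀ j → P j → m ℕ.≤ j) → AtLeast p G m
least≥ p G {m = m} eq Pk m≤ = subst (λ Q → ¬ ¬ ∃ λ a → Q a × m ℕ.≤ a) (sym eq)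
  (least-exists Pk >>= λ (a , Pa , a≤) → return (a , (Pa , a≤) , m≤ a Pa))

least≤ : ∀ (p : Parameter) G {P k} → p G ≡ IsLeast P → P k → AtMost p G k
least≤ p G {k = k} eq Pk = subst (λ Q → ¬ ¬ ∃ λ a → Q a × a ℕ.≤ k) (sym eq)
  (least-exists Pk >>= λ (a , Pa , a≤) → return (a , (Pa , a≤) , a≤ _ Pk))

-- Linear forests

consecutive⇒index : ∀ {u v : A} {xs} → Consecutive u v xs →
  ∃₂ λ (p : u ∈ xs) (q : v ∈ xs) → toℕ (index q) ≡ suc (toℕ (index p))
consecutive⇒index (here (refl ∷ refl ∷ [])) = here refl , there (here refl) , refl
consecutive⇒index (there uv) =
  let p , q , eq = consecutive⇒index uv in there p , there q , cong suc eq

consecutive-concat : ∀ {u v : A} {xss} → Any (Consecutive u v) xss → Consecutive u v (concat xss)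
consecutive-concat {xss = xs ∷ xss} (here uv)  = uv ⁱ++ concat xss
consecutive-concat {xss = xs ∷ xss} (there uv) = xs ++ⁱ consecutive-concat uv

module _ (G : Graph) where
  open Graph G

  everything-separates : SeparatesIntoPaths G ⊤ []
  everything-separates = [] ,
    (λ v → mk⇔ (λ v∉ → contradiction ∈⊤ v∉) (λ ())) ,
    (λ u v u∉ → contradiction ∈⊤ u∉)

  module _ {S ps} (sep : SeparatesIntoPaths G S ps) where

    private
      xs = concat ps

      -- Counted in the concatenation of all paths, so that one numbering covers all nodes outside
      -- `S`.
      position : ∀ {v} → v ∉ˢ S → ℕ
      position {v} v∉S = toℕ (index (Equivalence.to (proj₁ (proj₂ sep) v) v∉S))

      -- As the concatenation has no repetitions, membership proofs are unique, so the indices found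
      -- by `consecutive⇒index` are the positions.
      consecutive⇒position : ∀ {u v} (u∉S : u ∉ˢ S) (v∉S : v ∉ˢ S) →
        Any (Consecutive u v) ps → position v∉S ≡ suc (position u∉S)
      consecutive⇒position u∉S v∉S uv
        with p , q , eq ← consecutive⇒index (consecutive-concat uv)
        with refl ← unique⇒irrelevant (proj₁ sep) p (Equivalence.to (proj₁ (proj₂ sep) _) u∉S)
        with refl ← unique⇒irrelevant (proj₁ sep) q (Equivalence.to (proj₁ (proj₂ sep) _) v∉S)
        = eq

      edge⇒position : ∀ {u v} (u∉S : u ∉ˢ S) (v∉S : v ∉ˢ S) → E u v →
        position v∉S ≡ suc (position u∉S) ⊎ position u∉S ≡ suc (position v∉S)
      edge⇒position u∉S v∉S e =
        [ inj₁ ∘ consecutive⇒position u∉S v∉S , inj₂ ∘ consecutive⇒position v∉S u∉S ]′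
          (Anyₚ.Any-⊎⁻ (Equivalence.to (proj₂ (proj₂ sep) _ _ u∉S v∉S) e))

    -- Neighbours have positions of different parity.
    no-triangle : ∀ {u v w} → u ∉ˢ S → v ∉ˢ S → w ∉ˢ S → E u v → E v w → E u w → Empty.⊥
    no-triangle u∉S v∉S w∉S uv vw uw =
      odd-cycle (edge⇒position u∉S v∉S uv) (edge⇒position v∉S w∉S vw) (edge⇒position u∉S w∉S uw)
      where
      odd-cycle : ∀ {i j k : ℕ} → j ≡ suc i ⊎ i ≡ suc j → k ≡ suc j ⊎ j ≡ suc k →
        k ≡ suc i ⊎ i ≡ suc k → Empty.⊥
      odd-cycle (inj₁ refl) (inj₁ refl) (inj₁ ())
      odd-cycle (inj₁ refl) (inj₁ refl) (inj₂ ())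
      odd-cycle (inj₁ refl) (inj₂ refl) (inj₁ ())
      odd-cycle (inj₁ refl) (inj₂ refl) (inj₂ ())
      odd-cycle (inj₂ refl) (inj₁ refl) (inj₁ ())
      odd-cycle (inj₂ refl) (inj₁ refl) (inj₂ ())
      odd-cycle (inj₂ refl) (inj₂ refl) (inj₁ ())
      odd-cycle (inj₂ refl) (inj₂ refl) (inj₂ ())

-- Parameters of a single graph

module _ (G : Graph) where
  open Graph G

  stretch≥ : ∀ f {u v} → E u v → ℕ.∣ toℕ (f ⟨$⟩ʳ u) - toℕ (f ⟨$⟩ʳ v) ∣ ℕ.≤ stretch G f
  stretch≥ f {u} {v} e = All.lookup (xs≤max 0 _)
    (∈-map⁺ _ (∈-filter⁺ (uncurry E?) (∈-cartesianProduct⁺ (∈-allFin u) (∈-allFin v)) e))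

  stretch≤ : ∀ f {k} → (∀ {u v} → E u v → ℕ.∣ toℕ (f ⟨$⟩ʳ u) - toℕ (f ⟨$⟩ʳ v) ∣ ℕ.≤ k) →
    stretch G f ℕ.≤ k
  stretch≤ f short = max≤v⁺ z≤n (Allₚ.map⁺ (All.map short
    (Allₚ.all-filter (uncurry E?) (cartesianProduct (allFin n) (allFin n)))))

module _ (G : WeightedGraph) where
  open WeightedGraph G

  start∈nodes : ∀ {u v} (π : Star E u v) → u ∈ nodes π
  start∈nodes ε       = here refl
  start∈nodes (_ ◅ _) = here refl

  end∈nodes : ∀ {u v} (π : Star E u v) → v ∈ nodes π
  end∈nodes ε       = here refl
  end∈nodes (_ ◅ π) = there (end∈nodes π)

  highway₁≥ : ∀ {m} u r → r ℚ.> 0ℚ →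
    (∀ S → (∀ {a b} (π : Star E a b) → Shortest ℓ π → ∥ π ∥ ℚ.> r →
              All (Ball (+ 4 / 1 * r) u) (nodes π) → Hits G S π) → m ℕ.≤ ∣ S ∣) →
    AtLeast IsHighwayDimension₁ G m
  highway₁≥ u r r>0 large = least≥ IsHighwayDimension₁ G {k = n} refl
    -- Some bound must exist: the whole ball has at most `n` nodes and contains the start of every
    -- path inside it.
    (λ r r>0 u → let ball? = λ v → dist u v ℚₚ.≤? + 4 / 1 * r in
      subset ball? , (λ v → ∈-subset⁻ ball?) , ∣p∣≤n (subset ball?) ,
      λ π _ _ inBall → Any.map (λ { refl → ∈-subset⁺ ball? (All.lookup inBall (start∈nodes π)) })
                               (start∈nodes π))
    λ k hd → let S , _ , ∣S∣≤k , hits = hd r r>0 u in ℕₚ.≤-trans (large S hits) ∣S∣≤k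

  highway₂≥ : ∀ {m} u r → r ℚ.> 0ℚ →
    (∀ S → (∀ {a b} (π : Star E a b) → Shortest ℓ π → + 2 / 1 * r ℚ.≥ ∥ π ∥ → ∥ π ∥ ℚ.> r →
              Any (Ball (+ 2 / 1 * r) u) (nodes π) → Hits G S π) → m ℕ.≤ ∣ S ∣) →
    AtLeast IsHighwayDimension₂ G m
  highway₂≥ u r r>0 large = least≥ IsHighwayDimension₂ G {k = n} refl
    (λ r r>0 u → ⊤ , ∣p∣≤n (⊤ {n}) , λ π _ _ _ _ → Any.map (λ _ → ∈⊤) (start∈nodes π))
    λ k hd → let S , ∣S∣≤k , hits = hd r r>0 u in ℕₚ.≤-trans (large S hits) ∣S∣≤k

  -- A finite list containing the cut at depth `r`: a point of that depth on the edge from `u` to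
  -- `v` has offset `r - dist s u`. Entries outside the tree do no harm.
  points : V → ℚ → List (Point G)
  points s r = map node (allFin n) ++
    map (λ (u , v) → inner u v (r - dist s u)) (cartesianProduct (allFin n) (allFin n))

  cut⊆points : ∀ {s r x} → Cut G s r x → x ∈ points s r
  cut⊆points {x = node v} _ = ∈-++⁺ˡ (∈-map⁺ node (∈-allFin v))
  cut⊆points {s} {x = inner u v α} (_ , refl) = ∈-++⁺ʳ (map node (allFin n))
    (subst (λ α′ → inner u v α′ ∈ map point pairs)
      (solve 2 (λ d α → d :+ α :- d := α) refl (dist s u) α)
      (∈-map⁺ point (∈-cartesianProduct⁺ (∈-allFin u) (∈-allFin v))))
    where
    open ℚSolver.+-*-Solver
    r = dist s u + α
    pairs = cartesianProduct (allFin n) (allFin n)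
    point : V × V → Point G
    point (u , v) = inner u v (r - dist s u)

  cut-cardinality-exists : ∀ s r → ¬ ¬ ∃ (HasCardinality (Cut G s r))
  cut-cardinality-exists s r = cardinality-exists (points s r) (cut⊆points {s} {r})

  cut-cardinality≤ : ∀ {s r k} → HasCardinality (Cut G s r) k →
    k ℕ.≤ n ℕ.+ length (cartesianProduct (allFin n) (allFin n))
  cut-cardinality≤ {s} {r} (xs , xs! , cut⇔ , refl) = ℕₚ.≤-trans
    (⊆⇒length≤ xs! (λ {x} → cut⊆points {s} {r} ∘ Equivalence.from (cut⇔ x)))
    (ℕₚ.≤-reflexive (trans (length-++ (map node (allFin n)))
      (cong₂ ℕ._+_ (trans (length-map (node {G}) (allFin n)) (length-tabulate {n = n} id))
                   (length-map _ (cartesianProduct (allFin n) (allFin n))))))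

  -- A maximum needs two ingredients: the cut at depth 0 has some cardinality, and all cuts share a
  -- bound that depends only on `n`.
  skeleton-exists : V → ¬ ¬ ∃ (IsSkeletonDimension G)
  skeleton-exists s = cut-cardinality-exists s 0ℚ >>= λ (_ , card) →
    greatest-exists _ (λ { _ (s , r , _ , card) → cut-cardinality≤ {s} {r} card }) (s , 0ℚ , ℚₚ.≤-refl , card)

  skeleton≥ : ∀ {m} s r → r ℚ.≥ 0ℚ → (f : Fin m → Point G) →
    (∀ {i j} → f i ≡ f j → i ≡ j) → (∀ i → Cut G s r (f i)) → AtLeast IsSkeletonDimension G m
  skeleton≥ {m} s r r≥0 f inj f∈ =
    cut-cardinality-exists s r >>= λ (k , card@(xs , xs! , cut⇔ , len≡k)) →
    skeleton-exists s >>= λ (κ , isκ) → return (κ , isκ , (begin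
      m                        ≡⟨ length-tabulate f ⟨
      length (List.tabulate f) ≤⟨ ⊆⇒length≤ (Uniqueₚ.tabulate⁺ inj)
        (λ x∈ → let i , eq = ∈-tabulate⁻ x∈ in Equivalence.to (cut⇔ _) (subst (Cut G s r) (sym eq) (f∈ i))) ⟩
      length xs                ≡⟨ len≡k ⟩
      k                        ≤⟨ proj₂ isκ k (s , r , r≥0 , card) ⟩
      κ                        ∎))
    where open ℕₚ.≤-Reasoning

-- Windmills

module Windmill (m : ℕ) where

  -- `zero` is the hub; the tips `suc j` with j = 2i and j = 2i + 1 form blade i.
  V : Set
  V = Fin (suc (m ℕ.* 2))

  blade : Fin (m ℕ.* 2) → Fin m
  blade = quotient {m} 2

  data E : V → V → Set where
    out  : ∀ {j} → E zero (suc j)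
    back : ∀ {j} → E (suc j) zero
    rim  : ∀ {j k} → j ≢ k → blade j ≡ blade k → E (suc j) (suc k)

  E? : Decidable₂ E
  E? zero    zero    = no λ ()
  E? zero    (suc k) = yes out
  E? (suc j) zero    = yes back
  E? (suc j) (suc k) with j ≟ k | blade j ≟ blade k
  ... | yes j≡k | _      = no λ { (rim j≢k _) → j≢k j≡k }
  ... | no j≢k  | yes eq = yes (rim j≢k eq)
  ... | no _    | no ≢   = no λ { (rim _ eq) → ≢ eq }

  symmetric : ∀ {u v} → E u v → E v u
  symmetric out          = back
  symmetric back         = out
  symmetric (rim j≢k eq) = rim (j≢k ∘ sym) (sym eq)

  irreflexive : ∀ {u v} → u ≡ v → ¬ E u v
  irreflexive refl (rim j≢j _) = j≢j refl

  ℓ : ∀ {u v} → E u v → ℚ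
  ℓ _ = 1ℚ

  -- Shortest paths in a windmill

  ∥_∥₁ : ∀ {u v} → Star E u v → ℚ
  ∥_∥₁ = pathLength ℓ

  Minimal : ∀ {u v} → Star E u v → Set
  Minimal π = Shortest ℓ π

  length≥0 : ∀ {u v} (π : Star E u v) → 0ℚ ≤ ∥ π ∥₁
  length≥1 : ∀ {u v w} (e : E u w) (π : Star E w v) → 1ℚ ≤ ∥ e ◅ π ∥₁

  length≥0 ε       = ℚₚ.≤-refl
  length≥0 (e ◅ π) = ℚₚ.≤-trans (from-yes (0ℚ ℚₚ.≤? 1ℚ)) (length≥1 e π)

  length≥1 e π = ℚₚ.+-monoʳ-≤ 1ℚ (length≥0 π)

  length≥2 : ∀ {u v w w′} (e : E u w) (f : E w w′) (π : Star E w′ v) → + 2 / 1 ≤ ∥ e ◅ f ◅ π ∥₁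
  length≥2 e f π = ℚₚ.+-monoʳ-≤ 1ℚ (length≥1 f π)

  length≥3 : ∀ {u v w w′ w″} (e : E u w) (f : E w w′) (g : E w′ w″) (π : Star E w″ v) →
    + 3 / 1 ≤ ∥ e ◅ f ◅ g ◅ π ∥₁
  length≥3 e f g π = ℚₚ.+-monoʳ-≤ 1ℚ (length≥2 f g π)

  edge-shortest : ∀ {u v} (e : E u v) → Minimal (e ◅ ε)
  edge-shortest e ε       = contradiction e (irreflexive refl)
  edge-shortest e (f ◅ ρ) = length≥1 f ρ

  edge-unique : ∀ {u v} (e : E u v) {ρ : Star E u v} → Minimal ρ → SamePath (e ◅ ε) ρ
  edge-unique e {ε}         _ = contradiction e (irreflexive refl)
  edge-unique e {f ◅ ε}     _ = refl
  edge-unique e {f ◅ g ◅ ρ} s = contradiction (ℚₚ.≤-trans (length≥2 f g ρ) (s (e ◅ ε)))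
    (from-no (+ 2 / 1 ℚₚ.≤? 1ℚ))

  detour : ∀ j k → Star E (suc j) (suc k)
  detour j k = back ◅ out ◅ ε

  module _ {j k} (j≢k : j ≢ k) (≢blade : blade j ≢ blade k) where

    detour-shortest : Minimal (detour j k)
    detour-shortest ε               = contradiction refl j≢k
    detour-shortest (rim _ eq ◅ ε)  = contradiction eq ≢blade
    detour-shortest (e ◅ f ◅ ρ)     = length≥2 e f ρ

    -- Rim edges never leave a blade, so a walk of two edges between different blades passes the
    -- hub; walks of three or more edges have length at least 3.
    detour-unique : ∀ {ρ} → Minimal ρ → SamePath (detour j k) ρ
    detour-unique {ε}              _ = contradiction refl j≢k
    detour-unique {rim _ eq ◅ ε}   _ = contradiction eq ≢blade
    detour-unique {back ◅ f ◅ ε}   _ = refl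
    detour-unique {rim _ eq ◅ rim _ eq′ ◅ ε} _ = contradiction (trans eq eq′) ≢blade
    detour-unique {e ◅ f ◅ g ◅ ρ}  s = contradiction
      (ℚₚ.≤-trans (length≥3 e f g ρ) (s (detour j k))) (from-no (+ 3 / 1 ℚₚ.≤? + 2 / 1))

  trivial-unique : ∀ {u} {ρ : Star E u u} → Minimal ρ → SamePath ε ρ
  trivial-unique {ρ = ε}     _ = refl
  trivial-unique {ρ = e ◅ ρ} s =
    contradiction (ℚₚ.≤-trans (length≥1 e ρ) (s ε)) (from-no (1ℚ ℚₚ.≤? 0ℚ))

  uniqueShortest : ∀ u v → ∃! (SamePath {E = E} {u} {v}) Minimal
  uniqueShortest zero    zero    = ε , length≥0 , trivial-unique
  uniqueShortest zero    (suc k) = out ◅ ε , edge-shortest out , edge-unique out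
  uniqueShortest (suc j) zero    = back ◅ ε , edge-shortest back , edge-unique back
  uniqueShortest (suc j) (suc k) with j ≟ k | blade j ≟ blade k
  ... | yes refl | _      = ε , length≥0 , trivial-unique
  ... | no j≢k   | yes eq = rim j≢k eq ◅ ε , edge-shortest (rim j≢k eq) , edge-unique (rim j≢k eq)
  ... | no j≢k   | no ≢   = detour j k , detour-shortest j≢k ≢ , detour-unique j≢k ≢

  graph : Graph
  graph = record
    { n = suc (m ℕ.* 2) ; nonEmpty = _ ; E = E ; E? = E? ; symmetric = symmetric
    ; loopless = irreflexive ; connected = λ u v → proj₁ (uniqueShortest u v) }

  weighted : WeightedGraph
  weighted = record
    { graph = graph ; ℓ = ℓ ; ℓ-symmetric = λ _ _ → refl
    ; ℓ-positive = λ _ → from-yes (0ℚ ℚₚ.<? 1ℚ) ; uniqueShortest = uniqueShortest }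

  -- Blades, and the linear forest left without the hub

  tip tip′ : Fin m → V
  tip  i = suc (combine i zero)
  tip′ i = suc (combine i (suc zero))

  combine-blade : ∀ i (b : Fin 2) → blade (combine i b) ≡ i
  combine-blade i b = cong proj₁ (remQuot-combine {m} i b)

  tip-edge : ∀ i → E (tip i) (tip′ i)
  tip-edge i = rim (λ eq → contradiction (proj₂ (combine-injective i zero i (suc zero) eq)) λ ())
                   (trans (combine-blade i zero) (sym (combine-blade i (suc zero))))

  distanceToLinearForest : AtMost (ignoringWeights IsDistanceToLinearForest) weighted 1
  distanceToLinearForest = least≤ (ignoringWeights IsDistanceToLinearForest) weighted refl
    (⁅ zero ⁆ , ∣⁅x⁆∣≡1 (zero {m ℕ.* 2}) , paths ,
    Uniqueₚ.concat⁺ (Allₚ.tabulate⁺ path-unique) (AllPairsₚ.tabulate⁺ paths-disjoint) ,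
    (λ v → mk⇔ (covered v) (λ { v∈ refl∈ → hub∉ (subst (_∈ concat paths) (x∈⁅y⁆⇒x≡y zero refl∈) v∈) })) ,
    λ { zero    v       u∉ _  → contradiction (x∈⁅x⁆ zero) u∉
      ; (suc j) zero    _  v∉ → contradiction (x∈⁅x⁆ zero) v∉
      ; (suc j) (suc k) _  _  → mk⇔ consecutive adjacent })
    where
    path : Fin m → List V
    path i = tip i ∷ tip′ i ∷ []

    paths = List.tabulate path

    path-unique : ∀ i → Unique (path i)
    path-unique i = ((λ eq → irreflexive eq (tip-edge i)) ∷ []) ∷ [] ∷ []

    ∈path : ∀ {v i} → v ∈ path i → ∃ λ b → v ≡ suc (combine i b)
    ∈path (here eq)         = zero , eq
    ∈path (there (here eq)) = suc zero , eq

    paths-disjoint : ∀ {i j} → i ≢ j → ∀ {v} → ¬ (v ∈ path i × v ∈ path j)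
    paths-disjoint {i} {j} i≢j (v∈i , v∈j) with ∈path v∈i | ∈path v∈j
    ... | b , refl | c , eq = i≢j (combine-injectiveˡ i b j c (suc-injective eq))

    onPath : ∀ i b → suc (combine i b) ∈ path i
    onPath i zero       = here refl
    onPath i (suc zero) = there (here refl)

    covered : ∀ v → v ∉ˢ ⁅ zero ⁆ → v ∈ concat paths
    covered zero    v∉ = contradiction (x∈⁅x⁆ zero) v∉
    covered (suc j) _  = let i , b = remQuot {m} 2 j in
      subst (λ j → suc j ∈ concat paths) (combine-remQuot {m} 2 j)
        (∈-concat⁺′ (onPath i b) (∈-tabulate⁺ {f = path} i))

    hub∉ : zero ∉ concat paths
    hub∉ hub∈ with ∈-concat⁻′ paths hub∈
    ... | _ , hub∈path , path∈ with ∈-tabulate⁻ {f = path} path∈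
    ... | i , refl with ∈path hub∈path
    ... | _ , ()

    Joined : V → V → List V → Set
    Joined u v p = Consecutive u v p ⊎ Consecutive v u p

    joined : ∀ i b c → b ≢ c → Joined (suc (combine i b)) (suc (combine i c)) (path i)
    joined i zero       zero       b≢c = contradiction refl b≢c
    joined i zero       (suc zero) _   = inj₁ (here (refl ∷ refl ∷ []))
    joined i (suc zero) zero       _   = inj₂ (here (refl ∷ refl ∷ []))
    joined i (suc zero) (suc zero) b≢c = contradiction refl b≢c

    -- A tip is determined by its blade and its side. The ends of a rim edge share the blade and are
    -- distinct, so their sides differ and `joined` applies.
    consecutive : ∀ {j k} → E (suc j) (suc k) → Any (Joined (suc j) (suc k)) paths
    consecutive {j} {k} (rim j≢k eq) = subst₂ (λ j k → Any (Joined (suc j) (suc k)) paths)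
      (combine-remQuot {m} 2 j) (trans (cong (λ i → combine i c) eq) (combine-remQuot {m} 2 k))
      (Anyₚ.tabulate⁺ {f = path} (blade j) (joined (blade j) b c λ b≡c → j≢k
        (trans (sym (combine-remQuot {m} 2 j)) (trans (cong₂ combine eq b≡c) (combine-remQuot {m} 2 k)))))
      where b = proj₂ (remQuot {m} 2 j) ; c = proj₂ (remQuot {m} 2 k)

    edge : ∀ {u v i} → Consecutive u v (path i) → E u v
    edge (here (refl ∷ refl ∷ []))    = tip-edge _
    edge (there (here (_ ∷ ())))
    edge (there (there (here ())))

    adjacent : ∀ {u v} → Any (Joined u v) paths → E u v
    adjacent uv with Anyₚ.tabulate⁻ {f = path} uv
    ... | i , inj₁ uv = edge uv
    ... | i , inj₂ vu = symmetric (edge vu)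

  -- Bandwidth, skeleton and highway dimensions of a windmill

  stretchʷ : Permutation′ (suc (m ℕ.* 2)) → ℕ
  stretchʷ = stretch graph

  hub-stretch : ∀ f v → ℕ.∣ toℕ (f ⟨$⟩ʳ zero) - toℕ (f ⟨$⟩ʳ v) ∣ ℕ.≤ stretchʷ f
  hub-stretch f zero    = ℕₚ.≤-trans (ℕₚ.≤-reflexive (ℕₚ.∣n-n∣≡0 (toℕ (f ⟨$⟩ʳ zero)))) z≤n
  hub-stretch f (suc j) = stretch≥ graph f out

  -- The hub is adjacent to every other node, so the extreme positions 0 and 2m both lie within the
  -- stretch of the hub's position; hence 2m is at most twice the stretch.
  bandwidth : AtLeast (ignoringWeights IsBandwidth) weighted m
  bandwidth = least≥ (ignoringWeights IsBandwidth) weighted refl (Perm.id , refl)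
    λ { _ (f , refl) → ℕₚ.*-cancelʳ-≤ m _ 2 (begin
      m ℕ.* 2
        ≡⟨ toℕ-fromℕ (m ℕ.* 2) ⟨
      toℕ last
        ≤⟨ ℕₚ.m≤n+∣n-m∣ (toℕ last) (pos f) ⟩
      pos f ℕ.+ ℕ.∣ pos f - toℕ last ∣
        ≤⟨ ℕₚ.+-mono-≤ (ℕₚ.≤-trans (ℕₚ.m≤n+∣m-n∣ (pos f) 0) (within f zero)) (within f last) ⟩
      stretchʷ f ℕ.+ stretchʷ f
        ≡⟨ twice (stretchʷ f) ⟩
      stretchʷ f ℕ.* 2 ∎) }
    where
    open ℕₚ.≤-Reasoning
    last = fromℕ (m ℕ.* 2)
    pos : Permutation′ (suc (m ℕ.* 2)) → ℕ
    pos f = toℕ (f ⟨$⟩ʳ zero)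
    within : ∀ f (i : V) → ℕ.∣ pos f - toℕ i ∣ ℕ.≤ stretchʷ f
    within f i = subst (λ i → ℕ.∣ pos f - toℕ i ∣ ℕ.≤ stretchʷ f) (inverseʳ f)
      (hub-stretch f (f ⟨$⟩ˡ i))
    twice : ∀ k → k ℕ.+ k ≡ k ℕ.* 2
    twice k = trans (cong (k ℕ.+_) (sym (ℕₚ.+-identityʳ k))) (ℕₚ.*-comm 2 k)

  skeletonDimension : AtLeast IsSkeletonDimension weighted m
  skeletonDimension = skeleton≥ weighted zero ½ (from-yes (0ℚ ℚₚ.≤? ½))
    -- The points are the midpoints of `m` spokes; beyond each lies its tip at distance ½, more than
    -- the required ½ · ½.
    (λ i → inner zero (tip i) ½) (λ { {i} {j} eq → injective i j eq })
    λ i → (((tip i , here (refl ∷ refl ∷ [])) , out , from-yes (0ℚ ℚₚ.<? ½) , from-yes (½ ℚₚ.<? 1ℚ)) ,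
           node (tip i) , tt , here (refl ∷ refl ∷ []) , from-yes (½ * ½ ℚₚ.≤? 1ℚ - ½)) , refl
    where
    injective : ∀ i j → inner {weighted} zero (tip i) ½ ≡ inner zero (tip j) ½ → i ≡ j
    injective i j eq = combine-injectiveˡ i zero j zero (suc-injective (tips eq))
      where
      tips : ∀ {u v} → inner {weighted} zero u ½ ≡ inner zero v ½ → u ≡ v
      tips refl = refl

  -- The blades are disjoint, so hitting nodes chosen one per blade are distinct.
  hit-tips⇒m≤ : ∀ S → (∀ i → Any (_∈ˢ S) (tip i ∷ tip′ i ∷ [])) → m ℕ.≤ ∣ S ∣
  hit-tips⇒m≤ S hits = injection⇒≤∣S∣ S (λ i → suc (combine i (side (hits i))))
    (λ {i} {j} eq → combine-injectiveˡ i _ j _ (suc-injective eq)) (λ i → side∈ (hits i))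
    where
    side : ∀ {i} → Any (_∈ˢ S) (tip i ∷ tip′ i ∷ []) → Fin 2
    side (here _)  = zero
    side (there _) = suc zero
    side∈ : ∀ {i} (hit : Any (_∈ˢ S) (tip i ∷ tip′ i ∷ [])) → suc (combine i (side hit)) ∈ˢ S
    side∈ (here ∈S)         = ∈S
    side∈ (there (here ∈S)) = ∈S

  highwayDimension₁ : AtLeast IsHighwayDimension₁ weighted m
  -- With r = ½ every rim edge is longer than r, and its ends, at distance 1 from the hub, lie in
  -- the ball of radius 4r = 2.
  highwayDimension₁ = highway₁≥ weighted zero ½ (from-yes (0ℚ ℚₚ.<? ½)) λ S hits →
    hit-tips⇒m≤ S λ i → hits (tip-edge i ◅ ε) (edge-shortest (tip-edge i)) (from-yes (½ ℚₚ.<? 1ℚ))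
      (from-yes (1ℚ ℚₚ.≤? + 2 / 1) ∷ from-yes (1ℚ ℚₚ.≤? + 2 / 1) ∷ [])

  highwayDimension₂ : AtLeast IsHighwayDimension₂ weighted m
  -- Again r = ½: the length of a rim edge and the distance of its ends from the hub are 1, which
  -- meets both bounds 2r exactly.
  highwayDimension₂ = highway₂≥ weighted zero ½ (from-yes (0ℚ ℚₚ.<? ½)) λ S hits →
    hit-tips⇒m≤ S λ i → hits (tip-edge i ◅ ε) (edge-shortest (tip-edge i))
      (from-yes (1ℚ ℚₚ.≤? 1ℚ)) (from-yes (½ ℚₚ.<? 1ℚ)) (here (from-yes (1ℚ ℚₚ.≤? 1ℚ)))

-- Rational inequalities

open ℚSolver.+-*-Solver using (solve; _:=_; _:+_; _:-_; _:*_; :-_; con)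

8^_ : ℕ → ℚ
8^ zero    = 1ℚ
8^ (suc k) = + 8 / 1 * 8^ k

p≤q⇒0≤q-p : ∀ {p q} → p ≤ q → 0ℚ ≤ q - p
p≤q⇒0≤q-p {p} {q} p≤q = subst (_≤ q - p) (ℚₚ.+-inverseʳ p) (ℚₚ.+-monoˡ-≤ (ℚ.- p) p≤q)

p<q⇒0<q-p : ∀ {p q} → p < q → 0ℚ < q - p
p<q⇒0<q-p {p} {q} p<q = subst (_< q - p) (ℚₚ.+-inverseʳ p) (ℚₚ.+-monoˡ-< (ℚ.- p) p<q)

0≤q-p⇒p≤q : ∀ {p q} → 0ℚ ≤ q - p → p ≤ q
0≤q-p⇒p≤q {p} {q} 0≤ = subst₂ _≤_ (ℚₚ.+-identityˡ p)
  (solve 2 (λ p q → q :- p :+ p := q) refl p q) (ℚₚ.+-monoˡ-≤ p 0≤)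

0<q-p⇒p<q : ∀ {p q} → 0ℚ < q - p → p < q
0<q-p⇒p<q {p} {q} 0< = subst₂ _<_ (ℚₚ.+-identityˡ p)
  (solve 2 (λ p q → q :- p :+ p := q) refl p q) (ℚₚ.+-monoˡ-< p 0<)

-- For linear arithmetic: only an equation between the two differences remains, which the ring
-- solver settles.
≤-via : ∀ {p q p′ q′} → p ≤ q → q - p ≡ q′ - p′ → p′ ≤ q′
≤-via p≤q eq = 0≤q-p⇒p≤q (subst (0ℚ ≤_) eq (p≤q⇒0≤q-p p≤q))

<-via : ∀ {p q p′ q′} → p < q → q - p ≡ q′ - p′ → p′ < q′
<-via p<q eq = 0<q-p⇒p<q (subst (0ℚ <_) eq (p<q⇒0<q-p p<q))

+-cancelˡ-≤ : ∀ r {p q} → r + p ≤ r + q → p ≤ q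
+-cancelˡ-≤ r {p} {q} le = ≤-via le (solve 3 (λ r p q → (r :+ q) :- (r :+ p) := q :- p) refl r p q)

q<q+1 : ∀ q → q < q + 1ℚ
q<q+1 q = subst (_< q + 1ℚ) (ℚₚ.+-identityʳ q) (ℚₚ.+-monoʳ-< q (from-yes (0ℚ ℚₚ.<? 1ℚ)))

8^-positive : ∀ k → 0ℚ < 8^ k
8^-positive zero    = from-yes (0ℚ ℚₚ.<? 1ℚ)
8^-positive (suc k) = ℚₚ.*-monoʳ-<-pos (+ 8 / 1) (8^-positive k)

8^k<8^1+k : ∀ k → 8^ k < 8^ (suc k)
8^k<8^1+k k = <-via (ℚₚ.*-monoʳ-<-pos (+ 7 / 1) (8^-positive k))
  (solve 1 (λ p → con (+ 7 / 1) :* p :- con (+ 7 / 1) :* con 0ℚ := con (+ 8 / 1) :* p :- p) refl (8^ k))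

8^-mono : ∀ {j k} → j ℕ.≤ k → 8^ j ≤ 8^ k
8^-mono j≤k = go (ℕₚ.≤⇒≤′ j≤k)
  where
  go : ∀ {j k} → j ℕ.≤′ k → 8^ j ≤ 8^ k
  go ℕ.≤′-refl       = ℚₚ.≤-refl
  go (ℕ.≤′-step {k} j≤k) = ℚₚ.≤-trans (go j≤k) (ℚₚ.<⇒≤ (8^k<8^1+k k))

8^-strict : ∀ {j k} → j ℕ.< k → 8^ j < 8^ k
8^-strict {j} j<k = ℚₚ.<-≤-trans (8^k<8^1+k j) (8^-mono j<k)

-- Squares of paths

module SquaredPath (m : ℕ) where

  -- The nodes fall into `suc m` blocks of three consecutive ones, each a triangle; the successor
  -- keeps the graph nonempty.
  N : ℕ
  N = suc m ℕ.* 3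

  V : Set
  V = Fin N

  gap : V → V → ℕ
  gap u v = ℕ.∣ toℕ u - toℕ v ∣

  gap-sym : ∀ u v → gap u v ≡ gap v u
  gap-sym u v = ℕₚ.∣-∣-comm (toℕ u) (toℕ v)

  data E (u v : V) : Set where
    near : gap u v ≡ 1 → E u v
    skip : gap u v ≡ 2 → E u v

  E? : Decidable₂ E
  E? u v = map′ [ near , skip ]′ (λ { (near eq) → inj₁ eq ; (skip eq) → inj₂ eq })
    ((gap u v ℕₚ.≟ 1) ⊎-dec (gap u v ℕₚ.≟ 2))

  E-sym : ∀ {u v} → E u v → E v u
  E-sym {u} {v} (near eq) = near (trans (gap-sym v u) eq)
  E-sym {u} {v} (skip eq) = skip (trans (gap-sym v u) eq)

  irreflexive : ∀ {u v} → u ≡ v → ¬ E u v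
  irreflexive {u} refl (near eq) = contradiction (trans (sym (ℕₚ.∣n-n∣≡0 (toℕ u))) eq) λ ()
  irreflexive {u} refl (skip eq) = contradiction (trans (sym (ℕₚ.∣n-n∣≡0 (toℕ u))) eq) λ ()

  -- Positions grow so fast that at most one node v satisfies r < x v ≤ 8r.
  x : V → ℚ
  x v = 8^ toℕ v

  D : V → V → ℚ
  D u v = ℚ.∣ x u - x v ∣

  D-sym : ∀ u v → D u v ≡ D v u
  D-sym u v = trans (sym (ℚₚ.∣-p∣≡∣p∣ (x u - x v)))
    (cong ℚ.∣_∣ (solve 2 (λ a b → :- (a :- b) := b :- a) refl (x u) (x v)))

  D-triangle : ∀ u w v → D u v ≤ D u w + D w v
  D-triangle u w v = subst (_≤ D u w + D w v)
    (cong ℚ.∣_∣ (solve 3 (λ a b c → (a :- b) :+ (b :- c) := a :- c) refl (x u) (x w) (x v)))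
    (ℚₚ.∣p+q∣≤∣p∣+∣q∣ (x u - x w) (x w - x v))

  -- Along the path `D` is additive, so the extra 1 makes a skip edge strictly longer than the two
  -- near edges between the same ends.
  ℓ : ∀ {u v} → E u v → ℚ
  ℓ {u} {v} (near _) = D u v
  ℓ {u} {v} (skip _) = D u v + 1ℚ

  ℓ-symmetric : ∀ {u v} (e : E u v) (e′ : E v u) → ℓ e ≡ ℓ e′
  ℓ-symmetric {u} {v} (near _) (near _) = D-sym u v
  ℓ-symmetric {u} {v} (skip _) (skip _) = cong (_+ 1ℚ) (D-sym u v)
  ℓ-symmetric {u} {v} (near p) (skip q) = contradiction (trans (sym p) (trans (gap-sym u v) q)) λ ()
  ℓ-symmetric {u} {v} (skip p) (near q) = contradiction (trans (sym p) (trans (gap-sym u v) q)) λ ()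

  -- Walking up and walking down the path are treated alike: coord d grows in direction d.

  data Direction : Set where
    up down : Direction

  Before Step : Direction → V → V → Set
  Before up   u v = toℕ u ℕ.≤ toℕ v
  Before down u v = toℕ v ℕ.≤ toℕ u
  Step up   u v = toℕ v ≡ suc (toℕ u)
  Step down u v = toℕ u ≡ suc (toℕ v)

  coord : Direction → V → ℚ
  coord up   v = x v
  coord down v = ℚ.- x v

  direction : ∀ u v → ∃ λ d → Before d u v
  direction u v = [ (up ,_) , (down ,_) ]′ (ℕₚ.≤-total (toℕ u) (toℕ v))

  before-refl : ∀ d {u} → Before d u u
  before-refl up   = ℕₚ.≤-refl
  before-refl down = ℕₚ.≤-refl

  before-trans : ∀ d {u v w} → Before d u v → Before d v w → Before d u w
  before-trans up   p q = ℕₚ.≤-trans p q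
  before-trans down p q = ℕₚ.≤-trans q p

  before-antisym : ∀ d {u v} → Before d u v → Before d v u → u ≡ v
  before-antisym up   p q = toℕ-injective (ℕₚ.≤-antisym p q)
  before-antisym down p q = toℕ-injective (ℕₚ.≤-antisym q p)

  before-total : ∀ d u v → Before d u v ⊎ Before d v u
  before-total up   u v = ℕₚ.≤-total (toℕ u) (toℕ v)
  before-total down u v = ℕₚ.≤-total (toℕ v) (toℕ u)

  step⇒before : ∀ d {u v} → Step d u v → Before d u v
  step⇒before up   eq = ℕₚ.≤-trans (ℕₚ.n≤1+n _) (ℕₚ.≤-reflexive (sym eq))
  step⇒before down eq = ℕₚ.≤-trans (ℕₚ.n≤1+n _) (ℕₚ.≤-reflexive (sym eq))

  step⇒≢ : ∀ d {u v} → Step d u v → u ≢ v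
  step⇒≢ up   eq refl = ℕₚ.1+n≢n (sym eq)
  step⇒≢ down eq refl = ℕₚ.1+n≢n (sym eq)

  step-unique : ∀ d {u v w} → Step d u v → Step d u w → v ≡ w
  step-unique up   p q = toℕ-injective (trans p (sym q))
  step-unique down p q = toℕ-injective (ℕₚ.suc-injective (trans (sym p) q))

  advance : ∀ d {u v w} → Before d u v → u ≢ v → Step d u w → Before d w v
  advance up   u≤v u≢v eq = subst (ℕ._≤ _) (sym eq) (ℕₚ.≤∧≢⇒< u≤v (u≢v ∘ toℕ-injective))
  advance down v≤u u≢v eq = ℕₚ.m<1+n⇒m≤n (subst (_ ℕ.<_) eq (ℕₚ.≤∧≢⇒< v≤u (u≢v ∘ sym ∘ toℕ-injective)))

  next : ∀ d {u v} → Before d u v → u ≢ v → ∃ (Step d u)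
  next up {u} {v} u≤v u≢v = fromℕ< 1+u<N , toℕ-fromℕ< 1+u<N
    where
    1+u<N = ℕₚ.≤-<-trans (ℕₚ.≤∧≢⇒< u≤v (u≢v ∘ toℕ-injective)) (toℕ<n v)
  next down {zero}  {v} v≤0 u≢v = contradiction (toℕ-injective (sym (ℕₚ.n≤0⇒n≡0 v≤0))) u≢v
  next down {suc i} {v} _   _   = inject₁ i , cong suc (sym (toℕ-inject₁ i))

  gap-step : ∀ d {u v} → Step d u v → gap u v ≡ 1
  gap-step up   {u} {v} eq = trans (cong ℕ.∣ toℕ u -_∣ eq)
    (trans (ℕₚ.m≤n⇒∣m-n∣≡n∸m (ℕₚ.n≤1+n (toℕ u))) (ℕₚ.m+n∸n≡m 1 (toℕ u)))
  gap-step down {u} {v} eq = trans (gap-sym u v) (gap-step up {v} {u} eq)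

  gap-advance : ∀ d {u v w} → Step d u w → Before d w v → gap u v ≡ suc (gap w v)
  gap-advance up {u} {v} {w} eq w≤v = begin
    gap u v                   ≡⟨ ℕₚ.m≤n⇒∣m-n∣≡n∸m (ℕₚ.<⇒≤ u<v) ⟩
    toℕ v ℕ.∸ toℕ u           ≡⟨ ℕₚ.+-∸-assoc 1 u<v ⟩
    suc (toℕ v ℕ.∸ suc (toℕ u)) ≡⟨ cong (λ i → suc (toℕ v ℕ.∸ i)) eq ⟨
    suc (toℕ v ℕ.∸ toℕ w)     ≡⟨ cong suc (ℕₚ.m≤n⇒∣m-n∣≡n∸m w≤v) ⟨
    suc (gap w v)             ∎
    where
    open ≡-Reasoning
    u<v = subst (ℕ._≤ toℕ v) eq w≤v
  gap-advance down {u} {v} {w} eq v≤w = begin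
    gap u v                   ≡⟨ cong (λ i → ℕ.∣ i - toℕ v ∣) eq ⟩
    ℕ.∣ suc (toℕ w) - toℕ v ∣ ≡⟨ ℕₚ.m≤n⇒∣n-m∣≡n∸m (ℕₚ.m≤n⇒m≤1+n v≤w) ⟩
    suc (toℕ w) ℕ.∸ toℕ v     ≡⟨ ℕₚ.+-∸-assoc 1 v≤w ⟩
    suc (toℕ w ℕ.∸ toℕ v)     ≡⟨ cong suc (ℕₚ.m≤n⇒∣n-m∣≡n∸m v≤w) ⟨
    suc (gap w v)             ∎
    where open ≡-Reasoning

  gap≡1⇒step : ∀ d {u v} → gap u v ≡ 1 → Step d u v ⊎ Step d v u
  gap≡1⇒step up {u} {v} eq with ℕₚ.≤-total (toℕ u) (toℕ v)
  ... | inj₁ u≤v = inj₁ (trans (sym (ℕₚ.m∸n+n≡m u≤v))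
                     (cong (ℕ._+ toℕ u) (trans (sym (ℕₚ.m≤n⇒∣m-n∣≡n∸m u≤v)) eq)))
  ... | inj₂ v≤u = inj₂ (trans (sym (ℕₚ.m∸n+n≡m v≤u))
                     (cong (ℕ._+ toℕ v) (trans (sym (ℕₚ.m≤n⇒∣n-m∣≡n∸m v≤u)) eq)))
  gap≡1⇒step down eq = Sum.swap (gap≡1⇒step up eq)

  coord-mono : ∀ d {u v} → Before d u v → coord d u ≤ coord d v
  coord-mono up   u≤v = 8^-mono u≤v
  coord-mono down v≤u = ℚₚ.neg-antimono-≤ (8^-mono v≤u)

  coord-strict : ∀ d {u v} → Before d u v → u ≢ v → coord d u < coord d v
  coord-strict up   u≤v u≢v = 8^-strict (ℕₚ.≤∧≢⇒< u≤v (u≢v ∘ toℕ-injective))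
  coord-strict down v≤u u≢v = ℚₚ.neg-antimono-< (8^-strict (ℕₚ.≤∧≢⇒< v≤u (u≢v ∘ sym ∘ toℕ-injective)))

  coord-injective : ∀ d {u v} → coord d u ≡ coord d v → u ≡ v
  coord-injective d {u} {v} eq with u ≟ v | before-total d u v
  ... | yes u≡v | _        = u≡v
  ... | no u≢v  | inj₁ u≼v = contradiction (coord-strict d u≼v u≢v) (ℚₚ.<-irrefl eq)
  ... | no u≢v  | inj₂ v≼u = contradiction (coord-strict d v≼u (u≢v ∘ sym)) (ℚₚ.<-irrefl (sym eq))

  -- No node lies strictly between the ends of a step, so a node past `v` would be at `w` or beyond.
  step-reflects-< : ∀ d {u v w} → Step d v w → coord d u < coord d w → Before d u v
  step-reflects-< d {u} {v} {w} v→w cu<cw with u ≟ v | before-total d u v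
  ... | yes refl | _        = before-refl d
  ... | no _     | inj₁ u≼v = u≼v
  ... | no u≢v   | inj₂ v≼u = contradiction
    (ℚₚ.<-≤-trans cu<cw (coord-mono d (advance d v≼u (u≢v ∘ sym) v→w))) (ℚₚ.<-irrefl refl)

  D-coord : ∀ d {u v} → Before d u v → D u v ≡ coord d v - coord d u
  D-coord up   {u} {v} u≤v = trans (D-sym u v) (ℚₚ.0≤p⇒∣p∣≡p (p≤q⇒0≤q-p (8^-mono u≤v)))
  D-coord down {u} {v} v≤u = trans (ℚₚ.0≤p⇒∣p∣≡p (p≤q⇒0≤q-p (8^-mono v≤u)))
    (solve 2 (λ a b → a :- b := (:- b) :- (:- a)) refl (x u) (x v))

  D-additive : ∀ d {u w v} → Before d u w → Before d w v → D u w + D w v ≡ D u v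
  D-additive d {u} {w} {v} u≼w w≼v = begin
    D u w + D w v
      ≡⟨ cong₂ _+_ (D-coord d u≼w) (D-coord d w≼v) ⟩
    (coord d w - coord d u) + (coord d v - coord d w)
      ≡⟨ solve 3 (λ a b c → (b :- a) :+ (c :- b) := c :- a) refl (coord d u) (coord d w) (coord d v) ⟩
    coord d v - coord d u
      ≡⟨ D-coord d (before-trans d u≼w w≼v) ⟨
    D u v ∎
    where open ≡-Reasoning

  D-self : ∀ u → D u u ≡ 0ℚ
  D-self u = trans (D-coord up {u} {u} ℕₚ.≤-refl) (ℚₚ.+-inverseʳ (x u))

  D-positive : ∀ {u v} → u ≢ v → D u v ℚ.> 0ℚ
  D-positive {u} {v} u≢v = let d , u≼v = direction u v in
    subst (0ℚ <_) (sym (D-coord d u≼v)) (p<q⇒0<q-p (coord-strict d u≼v u≢v))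

  ℓ-positive : ∀ {u v} (e : E u v) → ℓ e ℚ.> 0ℚ
  ℓ-positive e@(near _) = D-positive λ u≡v → irreflexive u≡v e
  ℓ-positive e@(skip _) = ℚₚ.+-mono-< (D-positive λ u≡v → irreflexive u≡v e) (from-yes (0ℚ ℚₚ.<? 1ℚ))

  D≤ℓ : ∀ {u v} (e : E u v) → D u v ≤ ℓ e
  D≤ℓ         (near _) = ℚₚ.≤-refl
  D≤ℓ {u} {v} (skip _) = ℚₚ.<⇒≤ (q<q+1 (D u v))

  -- Shortest paths in the squared path

  ∥_∥ₚ : ∀ {u v} → Star E u v → ℚ
  ∥_∥ₚ = pathLength ℓ

  D≤length : ∀ {u v} (π : Star E u v) → D u v ≤ ∥ π ∥ₚ
  D≤length {u} ε = ℚₚ.≤-reflexive (D-self u)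
  D≤length {u} {v} (_◅_ {j = w} e π) =
    ℚₚ.≤-trans (D-triangle u w v) (ℚₚ.+-mono-≤ (D≤ℓ e) (D≤length π))

  -- By `D≤length` this means length exactly `D u v`, the least possible.
  Tight : ∀ {u v} → Star E u v → Set
  Tight {u} {v} π = ∥ π ∥ₚ ≤ D u v

  record TightEdge (d : Direction) (u w v : V) (e : E u w) (π : Star E w v) : Set where
    field
      step   : Step d u w
      before : Before d w v
      tight  : Tight π
      ℓ≡D    : ℓ e ≡ D u w

  -- A tight walk wastes nothing: a skip edge costs 1 too much, a step away from `v` lengthens the
  -- distance still to cover, and at `v` itself any edge is too much. Only the near edge towards `v`
  -- remains.
  tight-edge : ∀ d {u w v} → Before d u v → (e : E u w) (π : Star E w v) → Tight (e ◅ π) → TightEdge d u w v e π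
  tight-edge d {u} {w} {v} u≼v (skip q) π t = contradiction
    (ℚₚ.≤-<-trans (D-triangle u w v)
      (ℚₚ.<-≤-trans (ℚₚ.+-mono-<-≤ (q<q+1 (D u w)) (D≤length π)) t)) (ℚₚ.<-irrefl refl)
  tight-edge d {u} {w} {v} u≼v e@(near adj) π t with gap≡1⇒step d adj
  ... | inj₂ w→u = contradiction (ℚₚ.≤-<-trans turn (D-less w→u u≼v)) (ℚₚ.<-irrefl refl)
    where
    turn : D w v ≤ D u v
    turn = ℚₚ.≤-trans (ℚₚ.≤-trans (D≤length π)
      (subst (_≤ D u w + ∥ π ∥ₚ) (ℚₚ.+-identityˡ ∥ π ∥ₚ) (ℚₚ.+-monoˡ-≤ ∥ π ∥ₚ (ℚₚ.0≤∣p∣ (x u - x w))))) t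
    D-less : Step d w u → Before d u v → D u v < D w v
    D-less w→u u≼v = subst₂ _<_ (ℚₚ.+-identityˡ (D u v)) (D-additive d (step⇒before d w→u) u≼v)
      (ℚₚ.+-monoˡ-< (D u v) (D-positive (step⇒≢ d w→u)))
  ... | inj₁ u→w with u ≟ v
  ... | yes refl = contradiction (ℚₚ.<-≤-trans (D-positive (step⇒≢ d u→w))
    (ℚₚ.≤-trans (subst (_≤ D u w + ∥ π ∥ₚ) (ℚₚ.+-identityʳ (D u w))
      (ℚₚ.+-monoʳ-≤ (D u w) (ℚₚ.≤-trans (ℚₚ.0≤∣p∣ (x w - x u)) (D≤length π)))) t))
    (ℚₚ.<-irrefl (sym (D-self u)))
  ... | no u≢v = record
    { step   = u→w
    ; before = w≼v
    ; tight  = +-cancelˡ-≤ (D u w) (subst (D u w + ∥ π ∥ₚ ≤_) (sym (D-additive d (step⇒before d u→w) w≼v)) t)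
    ; ℓ≡D    = refl
    }
    where w≼v = advance d u≼v u≢v u→w

  -- By `tight-edge` both walks are forced to the same next node. One cannot stop while the other
  -- goes on, since a further step would pass the common end.
  tight-unique : ∀ d {u v} → Before d u v → (π ρ : Star E u v) → Tight π → Tight ρ → SamePath π ρ
  tight-unique d u≼v ε       ε       _ _ = refl
  tight-unique d u≼u ε       (e ◅ ρ) _ s =
    let open TightEdge (tight-edge d u≼u e ρ s) in
    contradiction (before-antisym d (step⇒before d step) before) (step⇒≢ d step)
  tight-unique d u≼u (e ◅ π) ε       t _ =
    let open TightEdge (tight-edge d u≼u e π t) in
    contradiction (before-antisym d (step⇒before d step) before) (step⇒≢ d step)
  tight-unique d {u} u≼v (e ◅ π) (f ◅ ρ) t s
    with tight-edge d u≼v e π t | tight-edge d u≼v f ρ s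
  ... | te | sf with step-unique d (TightEdge.step te) (TightEdge.step sf)
  ... | refl = cong (u ∷_) (tight-unique d (TightEdge.before te) π ρ (TightEdge.tight te) (TightEdge.tight sf))

  direct : ∀ k d {u v} → gap u v ≡ k → Before d u v → ∃ λ (π : Star E u v) → Tight π
  direct zero    d {u} {v} eq _ with toℕ-injective {i = u} {v} (ℕₚ.∣m-n∣≡0⇒m≡n eq)
  ... | refl = ε , ℚₚ.≤-reflexive (sym (D-self u))
  direct (suc k) d {u} {v} eq u≼v =
    let u≢v     = λ u≡v → contradiction (trans (sym eq) (ℕₚ.m≡n⇒∣m-n∣≡0 (cong toℕ u≡v))) λ ()
        w , u→w = next d u≼v u≢v
        w≼v     = advance d u≼v u≢v u→w
        π , t   = direct k d (ℕₚ.suc-injective (trans (sym (gap-advance d u→w w≼v)) eq)) w≼v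
    in near (gap-step d u→w) ◅ π ,
       subst (D u w + ∥ π ∥ₚ ≤_) (D-additive d (step⇒before d u→w) w≼v) (ℚₚ.+-monoʳ-≤ (D u w) t)

  direct-path : ∀ u v → ∃ λ (π : Star E u v) → Tight π
  direct-path u v = let d , u≼v = direction u v in direct (gap u v) d refl u≼v

  Minimal : ∀ {u v} → Star E u v → Set
  Minimal π = Shortest ℓ π

  -- The direct path attains the lower bound `D`, so every minimal walk attains it too.
  minimal⇒tight : ∀ {u v} (π : Star E u v) → Minimal π → Tight π
  minimal⇒tight {u} {v} π shortest = let ρ , t = direct-path u v in ℚₚ.≤-trans (shortest ρ) t

  uniqueShortest : ∀ u v → ∃! (SamePath {E = E} {u} {v}) Minimal
  uniqueShortest u v =
    let d , u≼v = direction u v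
        π , t   = direct-path u v
    in π , (λ ρ → ℚₚ.≤-trans t (D≤length ρ)) ,
       λ {ρ} shortest → tight-unique d u≼v π ρ t (minimal⇒tight ρ shortest)

  graph : Graph
  graph = record
    { n = N ; nonEmpty = _ ; E = E ; E? = E? ; symmetric = E-sym
    ; loopless = irreflexive ; connected = λ u v → proj₁ (direct-path u v) }

  weighted : WeightedGraph
  weighted = record
    { graph = graph ; ℓ = ℓ ; ℓ-symmetric = ℓ-symmetric
    ; ℓ-positive = ℓ-positive ; uniqueShortest = uniqueShortest }

  open WeightedGraph weighted using (dist; shortestPath)

  tight⇒length≡D : ∀ {u v} (π : Star E u v) → Tight π → ∥ π ∥ₚ ≡ D u v
  tight⇒length≡D π t = ℚₚ.≤-antisym t (D≤length π)

  shortestPath-tight : ∀ u v → Tight (shortestPath u v)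
  shortestPath-tight u v = proj₂ (direct-path u v)

  dist≡D : ∀ u v → dist u v ≡ D u v
  dist≡D u v = tight⇒length≡D (shortestPath u v) (shortestPath-tight u v)

  -- Distance to linear forest and bandwidth of the squared path

  distanceToLinearForest : AtLeast (ignoringWeights IsDistanceToLinearForest) weighted m
  distanceToLinearForest = least≥ (ignoringWeights IsDistanceToLinearForest) weighted refl
    (⊤ , refl , [] , everything-separates graph)
    -- `block-hit` picks a node of `S` in each of the `suc m` blocks, one more than required.
    λ { _ (S , refl , ps , sep) → ℕₚ.≤-trans (ℕₚ.n≤1+n m)
      (injection⇒≤∣S∣ S (λ i → combine i (proj₁ (block-hit S sep i)))
        (λ {i} {j} → combine-injectiveˡ i _ j _) (λ i → proj₂ (block-hit S sep i))) }
    where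
    block-gap : ∀ (i : Fin (suc m)) (b c : Fin 3) →
      gap (combine i b) (combine i c) ≡ ℕ.∣ toℕ b - toℕ c ∣
    block-gap i b c = trans (cong₂ ℕ.∣_-_∣ (toℕ-combine i b) (toℕ-combine i c))
        (ℕₚ.∣m+n-m+o∣≡∣n-o∣ (3 ℕ.* toℕ i) (toℕ b) (toℕ c))

    -- A block missed by `S` would be a triangle outside `S`.
    block-hit : ∀ S {ps} → SeparatesIntoPaths graph S ps → (i : Fin (suc m)) → ∃ λ b → combine i b ∈ˢ S
    block-hit S sep i with any? {n = 3} (λ b → combine i b ∈? S)
    ... | yes hit = hit
    ... | no ¬hit = Empty.⊥-elim (no-triangle graph sep
      (λ ∈S → ¬hit (zero , ∈S)) (λ ∈S → ¬hit (suc zero , ∈S)) (λ ∈S → ¬hit (suc (suc zero) , ∈S))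
      (near (block-gap i zero (suc zero)))
      (near (block-gap i (suc zero) (suc (suc zero))))
      (skip (block-gap i zero (suc (suc zero)))))

  bandwidth : AtMost (ignoringWeights IsBandwidth) weighted 2
  bandwidth =
    -- The property asks for an exact stretch, so the identity first enters with its own stretch,
    -- which is then bounded by 2.
    least≤ (ignoringWeights IsBandwidth) weighted refl (Perm.id , refl) >>= λ (b , isb , b≤) →
    return (b , isb , ℕₚ.≤-trans b≤ (stretch≤ graph Perm.id gap≤2))
    where
    gap≤2 : ∀ {u v} → E u v → gap u v ℕ.≤ 2
    gap≤2 (near eq) = ℕₚ.≤-trans (ℕₚ.≤-reflexive eq) (s≤s z≤n)
    gap≤2 (skip eq) = ℕₚ.≤-reflexive eq

  -- Highway dimensions of the squared path

  Scale : ℚ → V → Set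
  Scale r v = r < x v × x v ≤ + 8 / 1 * r

  scale? : ∀ r v → Dec (Scale r v)
  scale? r v = (r ℚₚ.<? x v) ×-dec (x v ℚₚ.≤? + 8 / 1 * r)

  -- A later node is at least eight times as far out, so r < `x u` gives 8r < `x v`.
  scale-separated : ∀ {r u v} → toℕ u ℕ.< toℕ v → Scale r u → ¬ Scale r v
  scale-separated {r} {u} {v} u<v (r<xu , _) (_ , xv≤8r) = ℚₚ.<-irrefl refl
    (ℚₚ.<-≤-trans (ℚₚ.*-monoʳ-<-pos (+ 8 / 1) r<xu) (ℚₚ.≤-trans (8^-mono u<v) xv≤8r))

  scale-unique : ∀ {r u v} → Scale r u → Scale r v → u ≡ v
  scale-unique {r} {u} {v} su sv with ℕₚ.<-cmp (toℕ u) (toℕ v)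
  ... | tri< u<v _ _ = contradiction sv (scale-separated u<v su)
  ... | tri≈ _ u≡v _ = toℕ-injective u≡v
  ... | tri> _ _ v<u = contradiction su (scale-separated v<u sv)

  x≤2D : ∀ {i j} → toℕ i ℕ.< toℕ j → x j ≤ + 2 / 1 * D i j
  x≤2D {i} {j} i<j = subst (λ d → x j ≤ + 2 / 1 * d) (sym (D-coord up {i} {j} (ℕₚ.<⇒≤ i<j)))
    -- From `x j` ≥ 8 `x i` and 6 `x i` ≥ 0 follows `x j` ≥ 2 `x i`, which rearranges to the claim.
    (≤-via (ℚₚ.+-mono-≤ (8^-mono i<j) (ℚₚ.*-monoˡ-≤-nonNeg (+ 6 / 1) (ℚₚ.<⇒≤ (8^-positive (toℕ i)))))
      (solve 2 (λ xi xj → (xj :+ con (+ 6 / 1) :* xi) :- (con (+ 8 / 1) :* xi :+ con (+ 6 / 1) :* con 0ℚ)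
                          := con (+ 2 / 1) :* (xj :- xi) :- xj) refl (x i) (x j)))

  D≤4r⇒x≤8r : ∀ {r i j} → toℕ i ℕ.< toℕ j → D i j ≤ + 4 / 1 * r → x j ≤ + 8 / 1 * r
  D≤4r⇒x≤8r {r} {i} {j} i<j D≤4r = ℚₚ.≤-trans (x≤2D {i} {j} i<j)
    (ℚₚ.≤-trans (ℚₚ.*-monoˡ-≤-nonNeg (+ 2 / 1) D≤4r) (ℚₚ.≤-reflexive (sym (ℚₚ.*-assoc (+ 2 / 1) (+ 4 / 1) r))))

  D<x : ∀ {i j} → toℕ i ℕ.≤ toℕ j → D i j < x j
  D<x {i} {j} i≤j = subst (_< x j) (sym (D-coord up {i} {j} i≤j))
    (<-via (8^-positive (toℕ i)) (solve 2 (λ xi xj → xi :- con 0ℚ := xj :- (xj :- xi)) refl (x i) (x j)))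

  D>r⇒< : ∀ {r i j} → r ℚ.> 0ℚ → r < D i j → toℕ i ℕ.≤ toℕ j → toℕ i ℕ.< toℕ j
  D>r⇒< {r} {i} {j} r>0 r<D i≤j = ℕₚ.≤∧≢⇒< i≤j λ i≡j →
    ℚₚ.<-irrefl (sym (trans (cong (λ k → D k j) (toℕ-injective i≡j)) (D-self j))) (ℚₚ.<-trans r>0 r<D)

  UpperEnd : ℚ → ∀ {a b} → Star E a b → Set
  UpperEnd r π = ∃₂ λ i j →
    i ∈ nodes π × j ∈ nodes π × toℕ i ℕ.< toℕ j × ∥ π ∥ₚ ≡ D i j × r < x j

  -- The two nodes are the ends of `π`, sorted. The length of `π` is their distance, which is below
  -- the position of the upper one because positions are positive.
  upper-end : ∀ {r a b} → r ℚ.> 0ℚ → (π : Star E a b) → Minimal π → r < ∥ π ∥ₚ → UpperEnd r π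
  upper-end {r} {a} {b} r>0 π shortest r<π = select (ℕₚ.≤-total (toℕ a) (toℕ b))
    where
    len = tight⇒length≡D π (minimal⇒tight π shortest)
    r<D = subst (r <_) len r<π
    select : toℕ a ℕ.≤ toℕ b ⊎ toℕ b ℕ.≤ toℕ a → UpperEnd r π
    select (inj₁ a≤b) = a , b , start∈nodes weighted π , end∈nodes weighted π ,
      D>r⇒< r>0 r<D a≤b , len , ℚₚ.<-trans r<D (D<x {a} {b} a≤b)
    select (inj₂ b≤a) = b , a , end∈nodes weighted π , start∈nodes weighted π ,
      D>r⇒< r>0 r<D′ b≤a , trans len (D-sym a b) , ℚₚ.<-trans r<D′ (D<x {b} {a} b≤a)
      where r<D′ = subst (r <_) (D-sym a b) r<D

  -- For fixed `r` and `u`, every path to be hit has its upper end at scale `r`, hence at one and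
  -- the same node.
  highwayDimension₁ : AtMost IsHighwayDimension₁ weighted 1
  highwayDimension₁ = least≤ IsHighwayDimension₁ weighted refl λ r r>0 u →
    let S , S⊆ , ∣S∣≤1 , ⊆S = at-most-one (λ v → scale? r v ×-dec (dist u v ℚₚ.≤? + 4 / 1 * r))
                                (λ (su , _) (sv , _) → scale-unique su sv)
    in S , (λ v → proj₂ ∘ S⊆) , ∣S∣≤1 , λ π shortest r<π inBall →
      let i , j , i∈π , j∈π , i<j , _ , r<xj = upper-end r>0 π shortest r<π
          ball = λ {v} (v∈π : v ∈ nodes π) → All.lookup inBall v∈π
      in Any.map (λ { refl → ⊆S ((r<xj , bound r u i<j (ball i∈π) (ball j∈π)) , ball j∈π) }) j∈π
    where
    -- If `u` is below `j`, then `D u j` ≤ 4r bounds `x j`. Otherwise `u` is at or above `j`, hence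
    -- above `i`, and `D i u` ≤ 4r bounds `x u`, which is at least `x j`.
    bound : ∀ r u {i j} → toℕ i ℕ.< toℕ j → dist u i ≤ + 4 / 1 * r → dist u j ≤ + 4 / 1 * r →
      x j ≤ + 8 / 1 * r
    bound r u {i} {j} i<j ui uj with ℕₚ.<-≤-connex (toℕ u) (toℕ j)
    ... | inj₁ u<j = D≤4r⇒x≤8r {r} {u} {j} u<j (subst (_≤ + 4 / 1 * r) (dist≡D u j) uj)
    ... | inj₂ j≤u = ℚₚ.≤-trans (8^-mono j≤u) (D≤4r⇒x≤8r {r} {i} {u} (ℕₚ.<-≤-trans i<j j≤u)
      (subst (_≤ + 4 / 1 * r) (trans (dist≡D u i) (D-sym u i)) ui))

  highwayDimension₂ : AtMost IsHighwayDimension₂ weighted 1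
  highwayDimension₂ = least≤ IsHighwayDimension₂ weighted refl λ r r>0 u →
    let S , _ , ∣S∣≤1 , ⊆S = at-most-one (scale? r) scale-unique
    in S , ∣S∣≤1 , λ π shortest π≤2r r<π _ →
      let i , j , _ , j∈π , i<j , len , r<xj = upper-end r>0 π shortest r<π
          -- Here the length of the path bounds the distance of its ends by 2r, weakened to the 4r
          -- that `D≤4r⇒x≤8r` takes.
          D≤4r = ℚₚ.≤-trans (subst (_≤ + 2 / 1 * r) len π≤2r)
            (ℚₚ.*-monoʳ-≤-nonNeg r {{ℚ.nonNegative (ℚₚ.<⇒≤ r>0)}} (from-yes (+ 2 / 1 ℚₚ.≤? + 4 / 1)))
      in Any.map (λ { refl → ⊆S (r<xj , D≤4r⇒x≤8r {r} {i} {j} i<j D≤4r) }) j∈π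

  -- Skeleton dimension of the squared path

  tight-consecutive : ∀ d {s v a b} → Before d s v → (π : Star E s v) → Tight π →
    Consecutive a b (nodes π) → Before d s a × Step d a b
  tight-consecutive d s≼v ε t (here (_ ∷ ()))
  tight-consecutive d s≼v ε t (there (here ()))
  tight-consecutive d {s} s≼v (e ◅ π) t ab with tight-edge d s≼v e π t | ab
  ... | te | there ab = let w≼a , a→b = tight-consecutive d (TightEdge.before te) π (TightEdge.tight te) ab in
    before-trans d (step⇒before d (TightEdge.step te)) w≼a , a→b
  ... | te | here (refl ∷ bπ) = before-refl d , subst (Step d s) (sym (first π bπ)) (TightEdge.step te)
    where
    first : ∀ {u v b} {bs} (π : Star E u v) → Prefix _≡_ (b ∷ bs) (nodes π) → b ≡ u
    first ε       (eq ∷ _) = eq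
    first (_ ◅ _) (eq ∷ _) = eq

  module _ (s : V) where

    -- The shortest path tree of `s` is the underlying path rooted at `s`, which consists of two
    -- rays, one per direction.
    Along : Direction → Point weighted → Set
    Along d (node v)      = Before d s v
    Along d (inner u v α) = Before d s u × Step d u v

    along : ∀ p → InTree weighted s p → ∃ λ d → Along d p
    along (node v)      _                  = direction s v
    along (inner u v α) ((y , uv) , _) = let d , s≼y = direction s y in
      d , tight-consecutive d s≼y (shortestPath s y) (shortestPath-tight s y) uv

    -- Extends `coord` to inner points; on a ray it differs from the depth by the constant
    -- `coord d s`.
    height : Direction → Point weighted → ℚ
    height d (node v)      = coord d v
    height d (inner u v α) = coord d u + α

    depth≡height : ∀ d p → Along d p → depth weighted s p ≡ height d p - coord d s
    depth≡height d (node v)      s≼v       = trans (dist≡D s v) (D-coord d s≼v)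
    depth≡height d (inner u v α) (s≼u , _) = trans
      (cong (_+ α) (trans (dist≡D s u) (D-coord d s≼u)))
      (solve 3 (λ u s α → (u :- s) :+ α := (u :+ α) :- s) refl (coord d u) (coord d s) α)

    -- The ends of a tree edge are one step apart, so the edge is near and its length is the
    -- difference of their coordinates.
    inner-bounds : ∀ d {u v α} → Along d (inner u v α) → InTree weighted s (inner u v α) →
      coord d u < coord d u + α × coord d u + α < coord d v
    inner-bounds d (_ , u→v) (_ , skip eq , _) = contradiction (trans (sym eq) (gap-step d u→v)) λ ()
    inner-bounds d {u} {v} {α} (_ , u→v) (_ , near _ , 0<α , α<D) =
      subst (_< coord d u + α) (ℚₚ.+-identityʳ (coord d u)) (ℚₚ.+-monoʳ-< (coord d u) 0<α) ,
      <-via (subst (α <_) (D-coord d (step⇒before d u→v)) α<D)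
        (solve 3 (λ u v α → (v :- u) :- α := v :- (u :+ α)) refl (coord d u) (coord d v) α)

    node-not-inner : ∀ d {w u v α} → Along d (inner u v α) → InTree weighted s (inner u v α) →
      coord d w ≢ coord d u + α
    node-not-inner d p@(_ , u→v) t eq =
      let lower , upper = inner-bounds d p t
          w≼u = step-reflects-< d u→v (subst (_< coord d _) (sym eq) upper)
      in ℚₚ.<-irrefl refl (ℚₚ.<-≤-trans (subst (coord d _ <_) (sym eq) lower) (coord-mono d w≼u))

    inner-start≼ : ∀ d {u v α u′ v′ α′} →
      Along d (inner u v α) → InTree weighted s (inner u v α) →
      Along d (inner u′ v′ α′) → InTree weighted s (inner u′ v′ α′) →
      coord d u + α ≡ coord d u′ + α′ → Before d u u′
    inner-start≼ d p t p′ t′ eq = step-reflects-< d (proj₂ p′)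
      (ℚₚ.<-trans (proj₁ (inner-bounds d p t))
        (subst (_< coord d _) (sym eq) (proj₂ (inner-bounds d p′ t′))))

    -- Inner points of equal height lie on the same edge: the start of each edge comes strictly
    -- before the end of the other, hence not after its start, and the next node is unique.
    height-injective : ∀ d p q → Along d p → InTree weighted s p → Along d q → InTree weighted s q →
      height d p ≡ height d q → p ≡ q
    height-injective d (node v) (node w) _ _ _ _ eq = cong node (coord-injective d eq)
    height-injective d (node w) (inner u v α) _ _ p t eq = contradiction eq (node-not-inner d p t)
    height-injective d (inner u v α) (node w) p t _ _ eq = contradiction (sym eq) (node-not-inner d p t)
    height-injective d (inner u v α) (inner u′ v′ α′) p t p′ t′ eq
      with before-antisym d (inner-start≼ d p t p′ t′ eq) (inner-start≼ d p′ t′ p t (sym eq))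
    ... | refl with step-unique d (proj₂ p) (proj₂ p′)
    ... | refl = cong (inner u v) (ℚ+.∙-cancelˡ (coord d u) α α′ eq)

    depth-injective : ∀ d p q → Along d p → InTree weighted s p → Along d q → InTree weighted s q →
      depth weighted s p ≡ depth weighted s q → p ≡ q
    depth-injective d p q ap tp aq tq eq = height-injective d p q ap tp aq tq
      (ℚ+.∙-cancelʳ (ℚ.- coord d s) (height d p) (height d q)
        (trans (sym (depth≡height d p ap)) (trans eq (depth≡height d q aq))))

    code : Direction → Fin 2
    code up   = zero
    code down = suc zero

    code-injective : ∀ {d e} → code d ≡ code e → d ≡ e
    code-injective {up}   {up}   _ = refl
    code-injective {down} {down} _ = refl

    -- On one ray, points of equal depth coincide, so a point of the cut is determined by its
    -- direction.
    cut-size : ∀ {r k} → HasCardinality (Cut weighted s r) k → k ℕ.≤ 2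
    cut-size {r} (xs , xs! , cut⇔ , refl) = injective-on⇒length≤ xs! (code ∘ proj₁ ∘ side)
      λ {p} {q} p∈ q∈ eq → depth-injective (proj₁ (side p∈)) p q
        (proj₂ (side p∈)) (tree p∈)
        (subst (λ d → Along d q) (sym (code-injective eq)) (proj₂ (side q∈))) (tree q∈)
        (trans (proj₂ (cut p∈)) (sym (proj₂ (cut q∈))))
      where
      cut : ∀ {p} → p ∈ xs → Cut weighted s r p
      cut {p} = Equivalence.from (cut⇔ p)
      tree : ∀ {p} → p ∈ xs → InTree weighted s p
      tree p∈ = proj₁ (proj₁ (cut p∈))
      side : ∀ {p} → p ∈ xs → ∃ λ d → Along d p
      side {p} p∈ = along p (tree p∈)

  skeletonDimension : AtMost IsSkeletonDimension weighted 2
  skeletonDimension = skeleton-exists weighted zero >>= λ { (κ , isκ@((s , r , _ , card) , _)) →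
    return (κ , isκ , cut-size s {r} card) }

-- The four incomparabilities

incomparable : ∀ {p q} c d →
  (∀ m → ∃ λ G → AtLeast p G m × AtMost q G c) →
  (∀ m → ∃ λ G → AtLeast q G m × AtMost p G d) → Incomparable p q
incomparable c d p≫q q≫p = unbounded c p≫q , unbounded d q≫p

theorem22 : Incomparable (ignoringWeights IsDistanceToLinearForest) (ignoringWeights IsBandwidth) ×
    Incomparable (ignoringWeights IsDistanceToLinearForest) IsSkeletonDimension ×
    Incomparable (ignoringWeights IsDistanceToLinearForest) IsHighwayDimension₁ ×
    Incomparable (ignoringWeights IsDistanceToLinearForest) IsHighwayDimension₂
theorem22 =
  -- The first constant bounds the other parameter on squared paths, the second the distance to
  -- linear forest on windmills.
  incomparable 2 1 (λ m → SP.weighted m , SP.distanceToLinearForest m , SP.bandwidth m)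
                   (λ m → W.weighted m , W.bandwidth m , W.distanceToLinearForest m) ,
  incomparable 2 1 (λ m → SP.weighted m , SP.distanceToLinearForest m , SP.skeletonDimension m)
                   (λ m → W.weighted m , W.skeletonDimension m , W.distanceToLinearForest m) ,
  incomparable 1 1 (λ m → SP.weighted m , SP.distanceToLinearForest m , SP.highwayDimension₁ m)
                   (λ m → W.weighted m , W.highwayDimension₁ m , W.distanceToLinearForest m) ,
  incomparable 1 1 (λ m → SP.weighted m , SP.distanceToLinearForest m , SP.highwayDimension₂ m)
                   (λ m → W.weighted m , W.highwayDimension₂ m , W.distanceToLinearForest m)
  where
  module W = Windmill
  module SP = SquaredPath
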